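{- The class of $(P_1+\overline{P_1+P_3})$-free chordal graphs has bounded clique-width.
   Context: All graphs are finite, simple and undirected. $G$ is $H$-free if it has no induced subgraph isomorphic to $H$. A graph is chordal if it contains no induced cycle $C_r$ with $r\geq 4$. $P_r$ is the path on $r$ vertices, $+$ denotes disjoint union and $\overline{G}$ the complement; $\overline{P_1+P_3}$ is the paw (a triangle with one pendant vertex), so $P_1+\overline{P_1+P_3}$ is the disjoint union of an isolated vertex and a paw. The clique-width of a graph $G$ is the minimum number $k$ of labels needed to construct $G$ using the operations: create a single vertex with label $i$; take the disjoint union of two labelled graphs; add all edges between vertices of label $i$ and vertices of label $j$ ($i\neq j$); rename label $i$ to $j$. A class of graphs has bounded clique-width if there is a constant $c$ such that every graph in the class has clique-width at most $c$. -}

module Defs where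

open import Data.Nat using (ℕ; zero; suc; _+_; _≤_; _≡ᵇ_)
open import Data.Fin using (Fin; toℕ; splitAt)
open import Data.Fin.Properties using () renaming (_≟_ to _≟ᶠ_)
open import Data.Fin.Permutation using (Permutation′; _⟨$⟩ʳ_)
open import Data.Bool using (Bool; true; false; _∧_; _∨_; not; if_then_else_)
open import Data.Sum using (_⊎_; inj₁; inj₂)
open import Data.Product using (Σ; _×_; ∃; ∃-syntax)
open import Relation.Nullary using (¬_; ⌊_⌋)
open import Relation.Binary.PropositionalEquality using (_≡_; _≢_)
open import Function.Definitions using (Injective)

record Graph : Set where
  constructor mkGraph
  field
    n   : ℕ
    adj : Fin n → Fin n → Bool
open Graph public

IsSimple : Graph → Set
IsSimple G = (∀ u v → adj G u v ≡ adj G v u) × (∀ u → adj G u u ≡ false)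

InducedSub : Graph → Graph → Set
InducedSub H G = Σ (Fin (n H) → Fin (n G)) λ f →
  Injective _≡_ _≡_ f × (∀ u v → adj H u v ≡ adj G (f u) (f v))

Free : Graph → Graph → Set
Free H G = ¬ InducedSub H G

P : ℕ → Graph
P r = mkGraph r λ i j → (suc (toℕ i) ≡ᵇ toℕ j) ∨ (suc (toℕ j) ≡ᵇ toℕ i)

C : ℕ → Graph
C r = mkGraph r λ i j → adj (P r) i j
  ∨ ((toℕ i ≡ᵇ 0) ∧ (suc (toℕ j) ≡ᵇ r))
  ∨ ((toℕ j ≡ᵇ 0) ∧ (suc (toℕ i) ≡ᵇ r))

_⊕_ : Graph → Graph → Graph
G ⊕ H = mkGraph (n G + n H) λ u v → go (splitAt (n G) u) (splitAt (n G) v)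
  where
  go : Fin (n G) ⊎ Fin (n H) → Fin (n G) ⊎ Fin (n H) → Bool
  go (inj₁ a) (inj₁ b) = adj G a b
  go (inj₂ a) (inj₂ b) = adj H a b
  go _ _ = false

co : Graph → Graph
co G = mkGraph (n G) λ u v → not (adj G u v) ∧ not ⌊ u ≟ᶠ v ⌋

paw : Graph
paw = co (P 1 ⊕ P 3)

P1+paw : Graph
P1+paw = P 1 ⊕ paw

Chordal : Graph → Set
Chordal G = ∀ r → 4 ≤ r → Free (C r) G

data CWExpr (k : ℕ) : ℕ → Set where
  vertex : Fin k → CWExpr k 1
  union  : ∀ {a b} → CWExpr k a → CWExpr k b → CWExpr k (a + b)
  join   : ∀ {a} (i j : Fin k) → i ≢ j → CWExpr k a → CWExpr k a
  rename : ∀ {a} (i j : Fin k) → CWExpr k a → CWExpr k a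

record LGraph (k m : ℕ) : Set where
  constructor mkL
  field
    lab  : Fin m → Fin k
    ladj : Fin m → Fin m → Bool
open LGraph public

eq? : ∀ {k} → Fin k → Fin k → Bool
eq? a b = ⌊ a ≟ᶠ b ⌋

eval : ∀ {k m} → CWExpr k m → LGraph k m
eval (vertex i) = mkL (λ _ → i) (λ _ _ → false)
eval (union {a} {b} e f) = mkL
  (λ u → labU (splitAt a u))
  (λ u v → adjU (splitAt a u) (splitAt a v))
  where
  E = eval e
  F = eval f
  labU : Fin a ⊎ Fin b → _
  labU (inj₁ x) = lab E x
  labU (inj₂ x) = lab F x
  adjU : Fin a ⊎ Fin b → Fin a ⊎ Fin b → Bool
  adjU (inj₁ x) (inj₁ y) = ladj E x y
  adjU (inj₂ x) (inj₂ y) = ladj F x y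
  adjU _ _ = false
eval (join i j _ e) = mkL (lab E) λ u v →
    ladj E u v
  ∨ (eq? (lab E u) i ∧ eq? (lab E v) j)
  ∨ (eq? (lab E u) j ∧ eq? (lab E v) i)
  where E = eval e
eval (rename i j e) = mkL (λ u → if eq? (lab E u) i then j else lab E u) (ladj E)
  where E = eval e

CwAtMost : ℕ → Graph → Set
CwAtMost k G = Σ (CWExpr k (n G)) λ e → Σ (Permutation′ (n G)) λ σ →
  ∀ u v → adj G u v ≡ ladj (eval e) (σ ⟨$⟩ʳ u) (σ ⟨$⟩ʳ v)

-- A class of graphs (predicate) has bounded clique-width.
-- Graphs with no vertices are excluded (clique-width is defined for
-- non-null graphs).
BoundedCW : (Graph → Set) → Set
BoundedCW 𝒞 = ∃[ c ] (∀ G → 𝒞 G → 1 ≤ n G → CwAtMost c G)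

{-# OPTIONS --safe #-}
module Submission where

-- A graph has bounded clique-width as soon as its vertex set can be split recursively into two
-- parts such that every set S that occurs has boundedly many neighbourhoods outside S.
-- Take a simplicial vertex v and K = N(v).  The vertices not adjacent to v induce a paw-free chordal
-- graph, and such a graph is dismantled by deleting isolated, pendant and twin vertices, so it
-- splits with at most one nonempty neighbourhood class per set.  For a far vertex d let M(d) be the
-- set of vertices of K not adjacent to d.  Excluding C4 and P1 + paw makes the sets M(d) laminar,
-- far vertices with disjoint M(d) non-adjacent and those with strictly nested M(d) adjacent, so
-- K and the far vertices split along the laminar family.
-- It remains to control the set F of far vertices with M = ∅.  If two sets M(d) are incomparable, then
-- all far vertices outside F have the same neighbours in F.  Otherwise the nonempty M(d) form a chain;
-- if it has at least three members, then the vertices strictly below the top one have the same neighbours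
-- in F, and if it has at most two, then K falls into few classes with respect to all far vertices.

open import Defs
open import Data.Bool using (Bool; true; false; _∧_; _∨_; not; if_then_else_; _≟_)
open import Data.Bool.Properties using (T-≡; not-injective; ∧-zeroʳ; ∧-identityʳ; ∨-identityʳ)
open import Data.Empty using (⊥; ⊥-elim)
open import Data.Fin using (Fin; zero; suc; toℕ; fromℕ<; splitAt; combine; remQuot; _↑ˡ_; _↑ʳ_)
import Data.Fin as Fin
open import Data.Fin.Permutation using (Permutation; permutation; ↔⇒≡; _⟨$⟩ʳ_)
open import Data.Fin.Patterns using (0F; 1F; 2F; 3F; 4F)
open import Data.Fin.Properties using (any?; all?; toℕ-injective; toℕ<n; combine-injective; remQuot-combine;
  join-splitAt; splitAt-↑ˡ; splitAt-↑ʳ) renaming (_≟_ to _≟ᶠ_)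
open import Data.Fin.Subset using (∣_∣)
import Data.Fin.Subset as Subset
open import Data.Fin.Subset.Properties using (p⊂q⇒∣p∣<∣q∣)
open import Data.List using (List; []; _∷_; allFin; cartesianProduct)
import Data.List.Membership.Propositional as L
open import Data.List.Membership.Propositional.Properties using (∈-allFin; ∈-cartesianProduct⁺)
open import Data.List.Relation.Unary.Any using (here; there)
open import Data.Nat using (ℕ; zero; suc; _+_; _*_; _≤_; _<_; _≡ᵇ_; z≤n; s≤s; _≤?_)
open import Data.Nat.Properties hiding (eq?; _≟_)
open import Data.Product using (Σ; ∃; _×_; _,_; proj₁; proj₂)
open import Data.Sum using (_⊎_; inj₁; inj₂; swap)
open import Data.Vec using (tabulate)
open import Data.Vec.Properties using (lookup∘tabulate; lookup⇒[]=; []=⇒lookup)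
open import Function using (case_of_)
open import Function.Bundles using (Equivalence)
open import Relation.Binary.Definitions using (tri<; tri≈; tri>)
open import Relation.Binary.PropositionalEquality hiding (J)
open import Relation.Nullary using (¬_; Dec; yes; no; does)
open import Relation.Nullary.Decidable using (dec-true; dec-false; _×-dec_; _→-dec_; ¬?)
open import Relation.Unary using (Decidable)

-- The obstacle is `F`: its vertices see all of K, so the laminar family says nothing about them,
-- and their adjacency to the far vertices with M(d) ≠ ∅ must be controlled separately. Two facts do
-- this. Without C4, the neighbourhood of d in `F` can only shrink when M(d) grows strictly. Without
-- P1 + paw, now with v as the pendant vertex, a far vertex missing k ∈ K dominates every edge
-- between far neighbours of k. In a chain these facts give nothing for the vertices missing the
-- largest set, so those stay with `F`. The cases differ only in which far vertices are split
-- together with K and which are left to the paw-free decomposition. `Layout` records this choice,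
-- and a single construction then serves all of them. Chordality enters twice: through C4 in the
-- arguments about M(d), and through holes of every length in the existence of simplicial vertices,
-- needed for v and again in every paw-free subgraph.

clash : ∀ {b} → b ≡ true → b ≡ false → ⊥
clash refl ()

≢true⇒≡false : ∀ {b} → ¬ b ≡ true → b ≡ false
≢true⇒≡false {false} _ = refl
≢true⇒≡false {true}  h = ⊥-elim (h refl)

bool-cases : ∀ b → b ≡ true ⊎ b ≡ false
bool-cases true  = inj₁ refl
bool-cases false = inj₂ refl

≡-from-⇔ : ∀ {a b} → (a ≡ true → b ≡ true) → (b ≡ true → a ≡ true) → a ≡ b
≡-from-⇔ {false} {false} _ _ = refl
≡-from-⇔ {false} {true}  _ g = g refl
≡-from-⇔ {true}  {false} f _ = sym (f refl)
≡-from-⇔ {true}  {true}  _ _ = refl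

∨-true⁻ : ∀ {a b} → a ∨ b ≡ true → a ≡ true ⊎ b ≡ true
∨-true⁻ {true}  _ = inj₁ refl
∨-true⁻ {false} h = inj₂ h

∨-trueˡ : ∀ {a} b → a ≡ true → a ∨ b ≡ true
∨-trueˡ _ refl = refl

∨-trueʳ : ∀ a {b} → b ≡ true → a ∨ b ≡ true
∨-trueʳ true  _ = refl
∨-trueʳ false h = h

∨-false⁻ : ∀ {a b} → a ∨ b ≡ false → a ≡ false × b ≡ false
∨-false⁻ {false} {false} _ = refl , refl

∧-true⁻ : ∀ {a b} → a ∧ b ≡ true → a ≡ true × b ≡ true
∧-true⁻ {true} {true} _ = refl , refl

does⁻ : ∀ {A : Set} (A? : Dec A) → does A? ≡ true → A
does⁻ (yes a) _ = a

eq?-refl : ∀ {k} (x : Fin k) → eq? x x ≡ true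
eq?-refl x with x ≟ᶠ x
... | yes _  = refl
... | no x≢x = ⊥-elim (x≢x refl)

eq?-≢ : ∀ {k} {x y : Fin k} → x ≢ y → eq? x y ≡ false
eq?-≢ {x = x} {y} x≢y with x ≟ᶠ y
... | yes x≡y = ⊥-elim (x≢y x≡y)
... | no _    = refl

eq?⁻ : ∀ {k} {x y : Fin k} → eq? x y ≡ true → x ≡ y
eq?⁻ {x = x} {y} h with x ≟ᶠ y
... | yes x≡y = x≡y

-- Unlike _≟ᶠ_, matching on this does not unfold the occurrences of eq? in a goal.
≡? : ∀ {k} (x y : Fin k) → Dec (x ≡ y)
≡? x y with x ≟ᶠ y
... | yes x≡y = yes x≡y
... | no x≢y  = no x≢y

-- Vertex sets, recursive splittings and neighbourhood classes

VSet : ℕ → Set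
VSet m = Fin m → Bool

module _ {m : ℕ} where

  infix 4 _∈_ _∉_

  _∈_ _∉_ : Fin m → VSet m → Set
  x ∈ S = S x ≡ true
  x ∉ S = S x ≡ false

  infix 4 _⊑_
  _⊑_ : VSet m → VSet m → Set
  S ⊑ T = ∀ x → x ∈ S → x ∈ T

  infixl 6 _-_
  _-_ : VSet m → Fin m → VSet m
  (S - v) x = S x ∧ not (eq? x v)

  ∈-delete⁺ : ∀ S {v x} → x ∈ S → x ≢ v → x ∈ S - v
  ∈-delete⁺ S x∈S x≢v = cong₂ (λ a b → a ∧ not b) x∈S (eq?-≢ x≢v)

  ∈-delete⁻ : ∀ S {v x} → x ∈ S - v → x ∈ S × x ≢ v
  ∈-delete⁻ S {v} {x} h with ∧-true⁻ {S x} h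
  ... | x∈S , x≠v = x∈S , λ { refl → clash (eq?-refl v) (not-injective x≠v) }

  ∉-delete : ∀ S v → v ∉ S - v
  ∉-delete S v = trans (cong (λ b → S v ∧ not b) (eq?-refl v)) (∧-zeroʳ (S v))

  size : VSet m → ℕ
  size S = ∣ tabulate S ∣

  size-< : ∀ {S T} x → (∀ y → y ∈ S → y ∈ T) → x ∈ T → x ∉ S → size S < size T
  size-< {S} {T} x S⊆T x∈T x∉S = p⊂q⇒∣p∣<∣q∣ {p = tabulate S} {tabulate T}
    ( (λ {y} y∈S → ∈⁺ T (S⊆T y (∈⁻ S y∈S)))
    , x , ∈⁺ T x∈T , λ x∈S → clash (∈⁻ S x∈S) x∉S)
    where
    ∈⁺ : ∀ R {y} → y ∈ R → y Subset.∈ tabulate R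
    ∈⁺ R {y} y∈R = lookup⇒[]= y (tabulate R) (trans (lookup∘tabulate R y) y∈R)
    ∈⁻ : ∀ R {y} → y Subset.∈ tabulate R → y ∈ R
    ∈⁻ R {y} y∈R = trans (sym (lookup∘tabulate R y)) ([]=⇒lookup y∈R)

  -- `Q` is attached to nodes: a singleton always has a single neighbourhood class. The constructor
  -- `empty` permits splits whose parts have not been shown to be inhabited.
  data Decomp (Q : VSet m → Set) (S : VSet m) : Set where
    empty : (∀ x → x ∉ S) → Decomp Q S
    leaf  : ∀ p → p ∈ S → (∀ x → x ∈ S → x ≡ p) → Decomp Q S
    node  : ∀ A B → (∀ x → S x ≡ A x ∨ B x) → (∀ x → x ∈ A → x ∉ B) → Q S →
            Decomp Q A → Decomp Q B → Decomp Q S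

  decomp-≐ : ∀ {Q S T} → (∀ x → S x ≡ T x) → Q T → Decomp Q S → Decomp Q T
  decomp-≐ S=T q (empty none) = empty λ x → trans (sym (S=T x)) (none x)
  decomp-≐ S=T q (leaf p p∈S only) = leaf p (trans (sym (S=T p)) p∈S) λ x x∈T → only x (trans (S=T x) x∈T)
  decomp-≐ S=T q (node A B S=A∪B A∩B=∅ _ a b) = node A B (λ x → trans (sym (S=T x)) (S=A∪B x)) A∩B=∅ q a b

  -- `U` stays fixed while `S` shrinks along the recursion, so `f` may use one common bound for all
  -- sets of the tree.
  decomp-map : ∀ {Q Q′ S U} → (∀ {T} → T ⊑ U → Q T → Q′ T) → S ⊑ U → Decomp Q S → Decomp Q′ S
  decomp-map f S⊆U (empty none) = empty none
  decomp-map f S⊆U (leaf p p∈S only) = leaf p p∈S only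
  decomp-map f S⊆U (node A B S=A∪B A∩B=∅ q a b) = node A B S=A∪B A∩B=∅ (f S⊆U q)
    (decomp-map f (λ x x∈A → S⊆U x (trans (S=A∪B x) (∨-trueˡ _ x∈A))) a)
    (decomp-map f (λ x x∈B → S⊆U x (trans (S=A∪B x) (∨-trueʳ (A x) x∈B))) b)


-- In the cut matrix between `S` and its complement, the row of a vertex depends on its class only,
-- so the number of labels bounds the number of distinct rows.
Separated : ∀ G {L : Set} → VSet (n G) → (Fin (n G) → L) → Set
Separated G S class = ∀ {u u′ w} → u ∈ S → u′ ∈ S → class u ≡ class u′ → w ∉ S → adj G u w ≡ adj G u′ w

Types : ∀ G → Set → VSet (n G) → Set
Types G L S = Σ (Fin (n G) → L) (Separated G S)

-- Simultaneous relabelling and joining inside clique-width expressions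

module Relabelling {K : ℕ} where

  renames : ∀ {m} → (Fin K → Fin K) → List (Fin K) → CWExpr K m → CWExpr K m
  renames φ []       e = e
  renames φ (i ∷ is) e = rename i (φ i) (renames φ is e)

  renames-ladj : ∀ {m} φ is (e : CWExpr K m) → ladj (eval (renames φ is e)) ≡ ladj (eval e)
  renames-ladj φ []       e = refl
  renames-ladj φ (i ∷ is) e = renames-ladj φ is e

  -- Idempotence makes the sequential renamings independent of their order.
  module _ (φ : Fin K → Fin K) (idem : ∀ l → φ (φ l) ≡ φ l) where

    Renamed : List (Fin K) → Fin K → Fin K → Set
    Renamed is l l′ = l′ ≡ φ l ⊎ (l′ ≡ l × ¬ l L.∈ is)

    renames-lab : ∀ {m} is (e : CWExpr K m) u →
                  Renamed is (lab (eval e) u) (lab (eval (renames φ is e)) u)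
    renames-lab [] e u = inj₂ (refl , λ ())
    renames-lab (i ∷ is) e u with lab (eval (renames φ is e)) u ≟ᶠ i | renames-lab is e u
    ... | yes e₁ | inj₁ e₂ = inj₁ (trans (cong φ (trans (sym e₁) e₂)) (idem _))
    ... | yes e₁ | inj₂ (e₂ , _) = inj₁ (cong φ (trans (sym e₁) e₂))
    ... | no ne  | inj₁ e₂ = inj₁ e₂
    ... | no ne  | inj₂ (e₂ , l∉is) = inj₂ (e₂ , λ { (here e₃) → ne (trans e₂ e₃) ; (there p) → l∉is p })

    relabel : ∀ {m} → CWExpr K m → CWExpr K m
    relabel = renames φ (allFin K)

    relabel-lab : ∀ {m} (e : CWExpr K m) u → lab (eval (relabel e)) u ≡ φ (lab (eval e) u)
    relabel-lab e u with renames-lab (allFin K) e u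
    ... | inj₁ p = p
    ... | inj₂ (_ , l∉) = ⊥-elim (l∉ (∈-allFin _))

    relabel-ladj : ∀ {m} (e : CWExpr K m) u v → ladj (eval (relabel e)) u v ≡ ladj (eval e) u v
    relabel-ladj e u v = cong (λ f → f u v) (renames-ladj φ (allFin K) e)

  module _ (J : Fin K → Fin K → Bool) where

    -- The operation `join` demands distinct labels, so diagonal pairs leave the expression alone.
    -- This is why `Linked` carries `a ≢ b` and `joined⁺` asks that `J` be irreflexive.
    joinIf : ∀ {m} → Fin K × Fin K → CWExpr K m → CWExpr K m
    joinIf (i , j) e with i ≟ᶠ j
    ... | yes _  = e
    ... | no i≢j = if J i j then join i j i≢j e else e

    joinAll : ∀ {m} → List (Fin K × Fin K) → CWExpr K m → CWExpr K m
    joinAll []       e = e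
    joinAll (p ∷ ps) e = joinIf p (joinAll ps e)

    Linked : List (Fin K × Fin K) → Fin K → Fin K → Set
    Linked ps a b = (a , b) L.∈ ps × J a b ≡ true × a ≢ b

    joinIf-lab : ∀ {m} p (e : CWExpr K m) → lab (eval (joinIf p e)) ≡ lab (eval e)
    joinIf-lab (i , j) e with i ≟ᶠ j
    ... | yes _ = refl
    ... | no i≢j with J i j
    ...   | true  = refl
    ...   | false = refl

    -- Since joins never touch labels, the effect of the whole sequence can be read off from the
    -- labels of the initial expression.
    joinAll-lab : ∀ {m} ps (e : CWExpr K m) → lab (eval (joinAll ps e)) ≡ lab (eval e)
    joinAll-lab []       e = refl
    joinAll-lab (p ∷ ps) e = trans (joinIf-lab p (joinAll ps e)) (joinAll-lab ps e)

    Pair : Fin K → Fin K → Fin K → Fin K → Set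
    Pair i j a b = (a ≡ i × b ≡ j) × J a b ≡ true × a ≢ b

    joinIf-mono : ∀ {m} p (e : CWExpr K m) u v → ladj (eval e) u v ≡ true → ladj (eval (joinIf p e)) u v ≡ true
    joinIf-mono (i , j) e u v h with i ≟ᶠ j
    ... | yes _ = h
    ... | no i≢j with J i j
    ...   | true  = ∨-trueˡ _ h
    ...   | false = h

    joinIf⁺ : ∀ {m} i j (e : CWExpr K m) u v →
              Pair i j (lab (eval e) u) (lab (eval e) v) ⊎ Pair i j (lab (eval e) v) (lab (eval e) u) →
              ladj (eval (joinIf (i , j) e)) u v ≡ true
    joinIf⁺ i j e u v (inj₁ ((refl , refl) , Jij , i≢j)) with i ≟ᶠ j
    ... | yes i≡j = ⊥-elim (i≢j i≡j)
    ... | no _ rewrite Jij = ∨-trueʳ (ladj (eval e) u v) (∨-trueˡ _ (cong₂ _∧_ (eq?-refl i) (eq?-refl j)))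
    joinIf⁺ i j e u v (inj₂ ((refl , refl) , Jij , i≢j)) with i ≟ᶠ j
    ... | yes i≡j = ⊥-elim (i≢j i≡j)
    ... | no _ rewrite Jij = ∨-trueʳ (ladj (eval e) u v)
            (∨-trueʳ (eq? (lab (eval e) u) i ∧ eq? (lab (eval e) v) j) (cong₂ _∧_ (eq?-refl j) (eq?-refl i)))

    joinIf⁻ : ∀ {m} i j (e : CWExpr K m) u v → ladj (eval (joinIf (i , j) e)) u v ≡ true →
              ladj (eval e) u v ≡ true ⊎
              Pair i j (lab (eval e) u) (lab (eval e) v) ⊎ Pair i j (lab (eval e) v) (lab (eval e) u)
    joinIf⁻ i j e u v h with i ≟ᶠ j
    ... | yes _ = inj₁ h
    ... | no i≢j with J i j in Jij
    ...   | false = inj₁ h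
    ...   | true with ∨-true⁻ h
    ...     | inj₁ h₁ = inj₁ h₁
    ...     | inj₂ h₂ with ∨-true⁻ {eq? (lab (eval e) u) i ∧ eq? (lab (eval e) v) j} h₂
    ...       | inj₁ h₃ = inj₂ (inj₁ (pair (∧-true⁻ h₃)))
      where
      pair : ∀ {a b} → eq? a i ≡ true × eq? b j ≡ true → Pair i j a b
      pair (p , q) rewrite eq?⁻ p | eq?⁻ q = (refl , refl) , Jij , i≢j
    ...       | inj₂ h₃ = inj₂ (inj₂ (pair (∧-true⁻ h₃)))
      where
      pair : ∀ {a b} → eq? a j ≡ true × eq? b i ≡ true → Pair i j b a
      pair (p , q) rewrite eq?⁻ p | eq?⁻ q = (refl , refl) , Jij , i≢j

    joinAll⁺ : ∀ {m} ps (e : CWExpr K m) u v →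
               ladj (eval e) u v ≡ true ⊎
               Linked ps (lab (eval e) u) (lab (eval e) v) ⊎ Linked ps (lab (eval e) v) (lab (eval e) u) →
               ladj (eval (joinAll ps e)) u v ≡ true
    joinAll⁺ [] e u v (inj₁ h) = h
    joinAll⁺ [] e u v (inj₂ (inj₁ (() , _)))
    joinAll⁺ [] e u v (inj₂ (inj₂ (() , _)))
    joinAll⁺ (p ∷ ps) e u v (inj₁ h) = joinIf-mono p (joinAll ps e) u v (joinAll⁺ ps e u v (inj₁ h))
    joinAll⁺ (p ∷ ps) e u v (inj₂ (inj₁ (there q , r))) =
      joinIf-mono p (joinAll ps e) u v (joinAll⁺ ps e u v (inj₂ (inj₁ (q , r))))
    joinAll⁺ (p ∷ ps) e u v (inj₂ (inj₂ (there q , r))) =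
      joinIf-mono p (joinAll ps e) u v (joinAll⁺ ps e u v (inj₂ (inj₂ (q , r))))
    joinAll⁺ ((i , j) ∷ ps) e u v (inj₂ (inj₁ (here refl , r))) = joinIf⁺ i j (joinAll ps e) u v
      (inj₁ (subst (λ f → Pair i j (f u) (f v)) (sym (joinAll-lab ps e)) ((refl , refl) , r)))
    joinAll⁺ ((i , j) ∷ ps) e u v (inj₂ (inj₂ (here refl , r))) = joinIf⁺ i j (joinAll ps e) u v
      (inj₂ (subst (λ f → Pair i j (f v) (f u)) (sym (joinAll-lab ps e)) ((refl , refl) , r)))

    joinAll⁻ : ∀ {m} ps (e : CWExpr K m) u v → ladj (eval (joinAll ps e)) u v ≡ true →
               ladj (eval e) u v ≡ true ⊎
               J (lab (eval e) u) (lab (eval e) v) ≡ true ⊎ J (lab (eval e) v) (lab (eval e) u) ≡ true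
    joinAll⁻ [] e u v h = inj₁ h
    joinAll⁻ ((i , j) ∷ ps) e u v h with joinIf⁻ i j (joinAll ps e) u v h
    ... | inj₁ h′ = joinAll⁻ ps e u v h′
    ... | inj₂ (inj₁ (_ , q , _)) = inj₂ (inj₁ (subst (λ f → J (f u) (f v) ≡ true) (joinAll-lab ps e) q))
    ... | inj₂ (inj₂ (_ , q , _)) = inj₂ (inj₂ (subst (λ f → J (f v) (f u) ≡ true) (joinAll-lab ps e) q))

    pairs : List (Fin K × Fin K)
    pairs = cartesianProduct (allFin K) (allFin K)

    joined : ∀ {m} → CWExpr K m → CWExpr K m
    joined = joinAll pairs

    joined-lab : ∀ {m} (e : CWExpr K m) u → lab (eval (joined e)) u ≡ lab (eval e) u
    joined-lab e u = cong (λ f → f u) (joinAll-lab pairs e)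

    joined⁺ : ∀ {m} (e : CWExpr K m) u v → (∀ l → J l l ≡ false) →
              ladj (eval e) u v ≡ true ⊎
              J (lab (eval e) u) (lab (eval e) v) ≡ true ⊎ J (lab (eval e) v) (lab (eval e) u) ≡ true →
              ladj (eval (joined e)) u v ≡ true
    joined⁺ e u v irr h = joinAll⁺ pairs e u v (linked h)
      where
      link : ∀ {a b} → J a b ≡ true → Linked pairs a b
      link {a} {b} Jab = ∈-cartesianProduct⁺ (∈-allFin a) (∈-allFin b) , Jab , λ { refl → clash Jab (irr a) }
      linked : _ → _
      linked (inj₁ h)        = inj₁ h
      linked (inj₂ (inj₁ h)) = inj₂ (inj₁ (link h))
      linked (inj₂ (inj₂ h)) = inj₂ (inj₂ (link h))

-- Boundedly many classes at every cut bound the clique-width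

module CliqueWidth (G : Graph) (adj-sym : ∀ u v → adj G u v ≡ adj G v u) (k′ : ℕ) where

  open Relabelling

  -- A successor, so that `zero` is available as a default class.
  k : ℕ
  k = suc k′

  -- Bank 0 carries the labels between steps; banks 1 and 2 are scratch space for one union.
  bank : Fin 3 → Fin k → Fin (3 * k)
  bank = combine

  onBanks : ∀ {A : Set} → (Fin 3 → Fin k → A) → Fin (3 * k) → A
  onBanks h l = h (proj₁ (remQuot {3} k l)) (proj₂ (remQuot {3} k l))

  onBanks-bank : ∀ {A : Set} (h : Fin 3 → Fin k → A) b a → onBanks h (bank b a) ≡ h b a
  onBanks-bank h b a = cong (λ p → h (proj₁ p) (proj₂ p)) (remQuot-combine {3} {k} b a)

  -- The class function is part of the data: a union produces its own classes, which in general
  -- differ from those supplied by the decomposition.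
  record Realisation (S : VSet (n G)) : Set where
    field
      order    : ℕ
      expr     : CWExpr (3 * k) order
      pos      : Fin order → Fin (n G)
      pos-inj  : ∀ {i j} → pos i ≡ pos j → i ≡ j
      pos-∈    : ∀ i → pos i ∈ S
      pos-onto : ∀ {x} → x ∈ S → ∃ λ i → pos i ≡ x
      class    : Fin (n G) → Fin k
      sep      : Separated G S class
      lab-pos  : ∀ i → lab (eval expr) i ≡ bank 0F (class (pos i))
      ladj-pos : ∀ i j → ladj (eval expr) i j ≡ adj G (pos i) (pos j)

  module _ {S A B : VSet (n G)} (S=A∪B : ∀ x → S x ≡ A x ∨ B x) (A∩B=∅ : ∀ x → x ∈ A → x ∉ B)
           (class : Fin (n G) → Fin k) (sep : Separated G S class)
           (RA : Realisation A) (RB : Realisation B) where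

    private
      module RA = Realisation RA
      module RB = Realisation RB

      A⊆S : A ⊑ S
      A⊆S x x∈A = trans (S=A∪B x) (∨-trueˡ _ x∈A)

      B⊆S : B ⊑ S
      B⊆S x x∈B = trans (S=A∪B x) (∨-trueʳ (A x) x∈B)

      B∩A=∅ : ∀ x → x ∈ B → x ∉ A
      B∩A=∅ x x∈B = ≢true⇒≡false λ x∈A → clash x∈B (A∩B=∅ x x∈A)

    -- Vertices with one class in a part may have different classes in `S`, so the new class is not
    -- a function of the old label. Sending each old class to the class of one chosen member repairs
    -- this: members of an old class agree outside the part, hence outside `S`. The default `zero`
    -- is reached only by classes without members.
    module Representative (T : VSet (n G)) (cl : Fin (n G) → Fin k) where

      classmate? : ∀ a → Dec (∃ λ u → u ∈ T × cl u ≡ a)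
      classmate? a = any? λ u → (T u ≟ true) ×-dec (cl u ≟ᶠ a)

      newClass : Fin k → Fin k
      newClass a with classmate? a
      ... | yes (u , _) = class u
      ... | no _        = zero

      rep : ∀ {u} → u ∈ T → ∃ λ r → r ∈ T × cl r ≡ cl u × newClass (cl u) ≡ class r
      rep {u} u∈T with classmate? (cl u)
      ... | yes (r , r∈T , e) = r , r∈T , e , refl
      ... | no none = ⊥-elim (none (u , u∈T , refl))

    private
      module PA = Representative A RA.class
      module PB = Representative B RB.class

      newClass : Fin (n G) → Fin k
      newClass x = if A x then PA.newClass (RA.class x) else PB.newClass (RB.class x)

      newClass-A : ∀ {x} → x ∈ A → newClass x ≡ PA.newClass (RA.class x)
      newClass-A {x} x∈A = cong (if_then PA.newClass (RA.class x) else PB.newClass (RB.class x)) x∈A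

      newClass-B : ∀ {x} → x ∈ B → newClass x ≡ PB.newClass (RB.class x)
      newClass-B {x} x∈B = cong (if_then PA.newClass (RA.class x) else PB.newClass (RB.class x)) (B∩A=∅ x x∈B)

      ∉S : ∀ {w} → w ∉ S → w ∉ A × w ∉ B
      ∉S {w} w∉S = ∨-false⁻ (trans (sym (S=A∪B w)) w∉S)

      rep : ∀ {u} → u ∈ S → ∃ λ r → r ∈ S × newClass u ≡ class r × (∀ {w} → w ∉ S → adj G u w ≡ adj G r w)
      rep {u} u∈S with ∨-true⁻ {A u} (trans (sym (S=A∪B u)) u∈S)
      ... | inj₁ u∈A = let r , r∈A , e , c = PA.rep u∈A in
              r , A⊆S r r∈A , trans (newClass-A u∈A) c , λ w∉S → RA.sep u∈A r∈A (sym e) (proj₁ (∉S w∉S))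
      ... | inj₂ u∈B = let r , r∈B , e , c = PB.rep u∈B in
              r , B⊆S r r∈B , trans (newClass-B u∈B) c , λ w∉S → RB.sep u∈B r∈B (sym e) (proj₂ (∉S w∉S))

      -- Each vertex has the same neighbours outside `S` as its representative, so the given
      -- separation is applied to the two representatives.
      newSep : Separated G S newClass
      newSep u∈S u′∈S e w∉S with rep u∈S | rep u′∈S
      ... | r , r∈S , c , same | r′ , r′∈S , c′ , same′ =
        trans (same w∉S) (trans (sep r∈S r′∈S (trans (sym c) (trans e c′)) w∉S) (sym (same′ w∉S)))

      cross? : ∀ a b → Dec (∃ λ u → (u ∈ A × RA.class u ≡ a) × ∃ λ w → (w ∈ B × RB.class w ≡ b) × adj G u w ≡ true)
      cross? a b = any? λ u → ((A u ≟ true) ×-dec (RA.class u ≟ᶠ a)) ×-dec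
                   any? λ w → ((B w ≟ true) ×-dec (RB.class w ≟ᶠ b)) ×-dec (adj G u w ≟ true)

      crossing : Fin 3 → Fin k → Fin 3 → Fin k → Bool
      crossing 0F a 1F b = does (cross? a b)
      crossing _  _ _  _ = false

      J : Fin (3 * k) → Fin (3 * k) → Bool
      J l l′ = onBanks (λ b a → onBanks (crossing b a) l′) l

      J-bank : ∀ b a b′ a′ → J (bank b a) (bank b′ a′) ≡ crossing b a b′ a′
      J-bank b a b′ a′ = trans (onBanks-bank (λ b a → onBanks (crossing b a) (bank b′ a′)) b a)
                               (onBanks-bank (crossing b a) b′ a′)

      crossing-irr : ∀ b a → crossing b a b a ≡ false
      crossing-irr 0F a = refl
      crossing-irr 1F a = refl
      crossing-irr 2F a = refl

      J-irr : ∀ l → J l l ≡ false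
      J-irr l = crossing-irr (proj₁ (remQuot {3} k l)) (proj₂ (remQuot {3} k l))

      -- One edge between two classes forces all of them: `RB.sep` replaces the end in `B` as seen
      -- from `A`, and `RA.sep` the end in `A` as seen from `B`.
      crossing-adj : ∀ {u w} → u ∈ A → w ∈ B → crossing 0F (RA.class u) 1F (RB.class w) ≡ adj G u w
      crossing-adj {u} {w} u∈A w∈B = ≡-from-⇔ to from
        where
        to : does (cross? (RA.class u) (RB.class w)) ≡ true → adj G u w ≡ true
        to h with does⁻ (cross? (RA.class u) (RB.class w)) h
        ... | u′ , (u′∈A , e) , w′ , (w′∈B , e′) , u′~w′ =
          trans (adj-sym u w) (trans (RB.sep w∈B w′∈B (sym e′) (A∩B=∅ u u∈A)) (trans (adj-sym w′ u)
            (trans (RA.sep u∈A u′∈A (sym e) (B∩A=∅ w′ w′∈B)) u′~w′)))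
        from : adj G u w ≡ true → does (cross? (RA.class u) (RB.class w)) ≡ true
        from h = dec-true (cross? (RA.class u) (RB.class w)) (u , (u∈A , refl) , w , (w∈B , refl) , h)

      -- `lift` keeps the labels of `B` apart from those of `A` until the joins are done. The detour
      -- through bank 2 keeps every map idempotent: `PA.newClass` itself need not be, so bank 0
      -- cannot be rewritten in place.
      lift gather drop : Fin 3 → Fin k → Fin (3 * k)
      lift 0F a = bank 1F a
      lift 1F a = bank 1F a
      lift 2F a = bank 2F a
      gather 0F a = bank 2F (PA.newClass a)
      gather 1F a = bank 2F (PB.newClass a)
      gather 2F a = bank 2F a
      drop 0F a = bank 0F a
      drop 1F a = bank 1F a
      drop 2F a = bank 0F a

      idempotent : ∀ h → (∀ b a → onBanks h (h b a) ≡ h b a) → ∀ l → onBanks h (onBanks h l) ≡ onBanks h l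
      idempotent h p l = p _ _

      lift-idem : ∀ l → onBanks lift (onBanks lift l) ≡ onBanks lift l
      lift-idem = idempotent lift λ { 0F a → onBanks-bank lift 1F a ; 1F a → onBanks-bank lift 1F a
                                    ; 2F a → onBanks-bank lift 2F a }

      gather-idem : ∀ l → onBanks gather (onBanks gather l) ≡ onBanks gather l
      gather-idem = idempotent gather λ { 0F a → onBanks-bank gather 2F _ ; 1F a → onBanks-bank gather 2F _
                                        ; 2F a → onBanks-bank gather 2F a }

      drop-idem : ∀ l → onBanks drop (onBanks drop l) ≡ onBanks drop l
      drop-idem = idempotent drop λ { 0F a → onBanks-bank drop 0F a ; 1F a → onBanks-bank drop 1F a
                                    ; 2F a → onBanks-bank drop 0F a }

      eA : CWExpr (3 * k) RA.order
      eA = RA.expr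

      eB : CWExpr (3 * k) RB.order
      eB = relabel (onBanks lift) lift-idem RB.expr

      eU eJ eG eD : CWExpr (3 * k) (RA.order + RB.order)
      eU = union eA eB
      eJ = joined J eU
      eG = relabel (onBanks gather) gather-idem eJ
      eD = relabel (onBanks drop) drop-idem eG

      pos⊎ : Fin RA.order ⊎ Fin RB.order → Fin (n G)
      pos⊎ (inj₁ i) = RA.pos i
      pos⊎ (inj₂ j) = RB.pos j

      pos : Fin (RA.order + RB.order) → Fin (n G)
      pos i = pos⊎ (splitAt RA.order i)

      labU : Fin RA.order ⊎ Fin RB.order → Fin (3 * k)
      labU (inj₁ i) = bank 0F (RA.class (RA.pos i))
      labU (inj₂ j) = bank 1F (RB.class (RB.pos j))

      eU-lab : ∀ i → lab (eval eU) i ≡ labU (splitAt RA.order i)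
      eU-lab i with splitAt RA.order i
      ... | inj₁ i′ = RA.lab-pos i′
      ... | inj₂ j′ = trans (relabel-lab (onBanks lift) lift-idem RB.expr j′)
                        (trans (cong (onBanks lift) (RB.lab-pos j′)) (onBanks-bank lift 0F _))

      eD-lab : ∀ i → lab (eval eD) i ≡ bank 0F (newClass (pos i))
      eD-lab i = trans (relabel-lab (onBanks drop) drop-idem eG i) (trans (cong (onBanks drop) eG-lab)
                   (onBanks-bank drop 2F _))
        where
        gathered : ∀ s → onBanks gather (labU s) ≡ bank 2F (newClass (pos⊎ s))
        gathered (inj₁ i) = trans (onBanks-bank gather 0F _) (cong (bank 2F) (sym (newClass-A (RA.pos-∈ i))))
        gathered (inj₂ j) = trans (onBanks-bank gather 1F _) (cong (bank 2F) (sym (newClass-B (RB.pos-∈ j))))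
        eG-lab : lab (eval eG) i ≡ bank 2F (newClass (pos i))
        eG-lab = trans (relabel-lab (onBanks gather) gather-idem eJ i)
                   (trans (cong (onBanks gather) (trans (joined-lab J eU i) (eU-lab i))) (gathered (splitAt RA.order i)))

      inner : Fin RA.order ⊎ Fin RB.order → Fin RA.order ⊎ Fin RB.order → Bool
      inner (inj₁ i) (inj₁ j) = adj G (RA.pos i) (RA.pos j)
      inner (inj₂ i) (inj₂ j) = adj G (RB.pos i) (RB.pos j)
      inner _        _        = false

      eU-ladj : ∀ i j → ladj (eval eU) i j ≡ inner (splitAt RA.order i) (splitAt RA.order j)
      eU-ladj i j with splitAt RA.order i | splitAt RA.order j
      ... | inj₁ i′ | inj₁ j′ = RA.ladj-pos i′ j′
      ... | inj₁ i′ | inj₂ j′ = refl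
      ... | inj₂ i′ | inj₁ j′ = refl
      ... | inj₂ i′ | inj₂ j′ = trans (relabel-ladj (onBanks lift) lift-idem RB.expr i′ j′) (RB.ladj-pos i′ j′)

      total : ∀ s t → (inner s t ≡ true ⊎ J (labU s) (labU t) ≡ true ⊎ J (labU t) (labU s) ≡ true → adj G (pos⊎ s) (pos⊎ t) ≡ true)
                    × (adj G (pos⊎ s) (pos⊎ t) ≡ true → inner s t ≡ true ⊎ J (labU s) (labU t) ≡ true ⊎ J (labU t) (labU s) ≡ true)
      total (inj₁ i) (inj₁ j) = (λ { (inj₁ h) → h
                                   ; (inj₂ (inj₁ h)) → ⊥-elim (clash h (J-bank 0F a 0F a′))
                                   ; (inj₂ (inj₂ h)) → ⊥-elim (clash h (J-bank 0F a′ 0F a)) }) , inj₁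
        where a = RA.class (RA.pos i) ; a′ = RA.class (RA.pos j)
      total (inj₂ i) (inj₂ j) = (λ { (inj₁ h) → h
                                   ; (inj₂ (inj₁ h)) → ⊥-elim (clash h (J-bank 1F a 1F a′))
                                   ; (inj₂ (inj₂ h)) → ⊥-elim (clash h (J-bank 1F a′ 1F a)) }) , inj₁
        where a = RB.class (RB.pos i) ; a′ = RB.class (RB.pos j)
      total (inj₁ i) (inj₂ j) = (λ { (inj₂ (inj₁ h)) → trans (sym eq) h
                                   ; (inj₂ (inj₂ h)) → ⊥-elim (clash h (J-bank 1F b 0F a)) }) ,
                                λ h → inj₂ (inj₁ (trans eq h))
        where
        a = RA.class (RA.pos i)
        b = RB.class (RB.pos j)
        eq : J (bank 0F a) (bank 1F b) ≡ adj G (RA.pos i) (RB.pos j)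
        eq = trans (J-bank 0F a 1F b) (crossing-adj (RA.pos-∈ i) (RB.pos-∈ j))
      total (inj₂ i) (inj₁ j) = (λ { (inj₂ (inj₂ h)) → trans (sym eq) h
                                   ; (inj₂ (inj₁ h)) → ⊥-elim (clash h (J-bank 1F b 0F a)) }) ,
                                λ h → inj₂ (inj₂ (trans eq h))
        where
        a = RA.class (RA.pos j)
        b = RB.class (RB.pos i)
        eq : J (bank 0F a) (bank 1F b) ≡ adj G (RB.pos i) (RA.pos j)
        eq = trans (J-bank 0F a 1F b) (trans (crossing-adj (RA.pos-∈ j) (RB.pos-∈ i)) (adj-sym _ _))

      eD-ladj : ∀ i j → ladj (eval eD) i j ≡ adj G (pos i) (pos j)
      eD-ladj i j = trans (relabel-ladj (onBanks drop) drop-idem eG i j)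
        (trans (relabel-ladj (onBanks gather) gather-idem eJ i j)
          (≡-from-⇔ (λ h → proj₁ T (to (joinAll⁻ J (pairs J) eU i j h)))
                    (λ h → joined⁺ J eU i j J-irr (from (proj₂ T h)))))
        where
        T = total (splitAt RA.order i) (splitAt RA.order j)
        J-lab : ∀ i j → J (lab (eval eU) i) (lab (eval eU) j) ≡ J (labU (splitAt RA.order i)) (labU (splitAt RA.order j))
        J-lab i j = cong₂ J (eU-lab i) (eU-lab j)
        to : _ → _
        to (inj₁ h) = inj₁ (trans (sym (eU-ladj i j)) h)
        to (inj₂ (inj₁ h)) = inj₂ (inj₁ (trans (sym (J-lab i j)) h))
        to (inj₂ (inj₂ h)) = inj₂ (inj₂ (trans (sym (J-lab j i)) h))
        from : _ → _
        from (inj₁ h) = inj₁ (trans (eU-ladj i j) h)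
        from (inj₂ (inj₁ h)) = inj₂ (inj₁ (trans (J-lab i j) h))
        from (inj₂ (inj₂ h)) = inj₂ (inj₂ (trans (J-lab j i) h))

      pos⊎-inj : ∀ s t → pos⊎ s ≡ pos⊎ t → s ≡ t
      pos⊎-inj (inj₁ i) (inj₁ j) e = cong inj₁ (RA.pos-inj e)
      pos⊎-inj (inj₂ i) (inj₂ j) e = cong inj₂ (RB.pos-inj e)
      pos⊎-inj (inj₁ i) (inj₂ j) e = ⊥-elim (clash (subst (_∈ B) (sym e) (RB.pos-∈ j)) (A∩B=∅ _ (RA.pos-∈ i)))
      pos⊎-inj (inj₂ i) (inj₁ j) e = ⊥-elim (clash (subst (_∈ B) e (RB.pos-∈ i)) (A∩B=∅ _ (RA.pos-∈ j)))

      pos-inj : ∀ {i j} → pos i ≡ pos j → i ≡ j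
      pos-inj {i} {j} e = trans (sym (join-splitAt RA.order RB.order i))
        (trans (cong (Fin.join RA.order RB.order) (pos⊎-inj (splitAt RA.order i) (splitAt RA.order j) e)) (join-splitAt RA.order RB.order j))

      pos-∈ : ∀ i → pos i ∈ S
      pos-∈ i with splitAt RA.order i
      ... | inj₁ i′ = A⊆S _ (RA.pos-∈ i′)
      ... | inj₂ j′ = B⊆S _ (RB.pos-∈ j′)

      pos-onto : ∀ {x} → x ∈ S → ∃ λ i → pos i ≡ x
      pos-onto {x} x∈S with ∨-true⁻ {A x} (trans (sym (S=A∪B x)) x∈S)
      ... | inj₁ x∈A = let i , e = RA.pos-onto x∈A in
              i ↑ˡ RB.order , trans (cong pos⊎ (splitAt-↑ˡ RA.order i RB.order)) e
      ... | inj₂ x∈B = let j , e = RB.pos-onto x∈B in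
              RA.order ↑ʳ j , trans (cong pos⊎ (splitAt-↑ʳ RA.order RB.order j)) e

    realise-∪ : Realisation S
    realise-∪ = record
      { order = RA.order + RB.order ; expr = eD ; pos = pos ; pos-inj = pos-inj ; pos-∈ = pos-∈
      ; pos-onto = pos-onto ; class = newClass ; sep = newSep ; lab-pos = eD-lab ; ladj-pos = eD-ladj }

  realise-≐ : ∀ {S T} → (∀ x → S x ≡ T x) → Realisation S → Realisation T
  realise-≐ S=T R = record
    { order = order ; expr = expr ; pos = pos ; pos-inj = pos-inj
    ; pos-∈ = λ i → trans (sym (S=T _)) (pos-∈ i) ; pos-onto = λ x∈T → pos-onto (trans (S=T _) x∈T)
    ; class = class
    ; sep = λ u∈ u′∈ e w∉ → sep (trans (S=T _) u∈) (trans (S=T _) u′∈) e (trans (S=T _) w∉)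
    ; lab-pos = lab-pos ; ladj-pos = ladj-pos }
    where open Realisation R

  realise : (∀ u → adj G u u ≡ false) → ∀ {S} → Decomp (Types G (Fin k)) S → (∀ x → x ∉ S) ⊎ Realisation S
  realise irr (empty none) = inj₁ none
  realise irr (leaf p p∈S only) = inj₂ (record
    { order = 1 ; expr = vertex (bank 0F zero) ; pos = λ _ → p ; pos-inj = λ { {0F} {0F} _ → refl }
    ; pos-∈ = λ _ → p∈S ; pos-onto = λ x∈S → 0F , sym (only _ x∈S) ; class = λ _ → zero
    ; sep = λ {u} {u′} {w} u∈ u′∈ _ _ → cong (λ x → adj G x w) (trans (only u u∈) (sym (only u′ u′∈)))
    ; lab-pos = λ _ → refl ; ladj-pos = λ _ _ → sym (irr p) })
  realise irr (node A B S=A∪B A∩B=∅ (class , sep) a b) with realise irr a | realise irr b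
  ... | inj₁ A=∅ | inj₁ B=∅ = inj₁ λ x → trans (S=A∪B x) (cong₂ _∨_ (A=∅ x) (B=∅ x))
  ... | inj₁ A=∅ | inj₂ RB  = inj₂ (realise-≐ (λ x → sym (trans (S=A∪B x) (cong (_∨ B x) (A=∅ x)))) RB)
  ... | inj₂ RA  | inj₁ B=∅ =
          inj₂ (realise-≐ (λ x → sym (trans (S=A∪B x) (trans (cong (A x ∨_) (B=∅ x)) (∨-identityʳ _)))) RA)
  ... | inj₂ RA  | inj₂ RB  = inj₂ (realise-∪ S=A∪B A∩B=∅ class sep RA RB)

  -- `CwAtMost` fixes the size of the expression to be `n G`, whereas the order of a realisation
  -- equals it only through the bijection; the equation is matched here.
  cw-from-permutation : ∀ {m} → m ≡ n G → (e : CWExpr (3 * k) m) (σ : Permutation (n G) m) →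
    (∀ u v → adj G u v ≡ ladj (eval e) (σ ⟨$⟩ʳ u) (σ ⟨$⟩ʳ v)) → CwAtMost (3 * k) G
  cw-from-permutation refl e σ h = e , σ , h

  cw-bound : (∀ u → adj G u u ≡ false) → 1 ≤ n G → Decomp (Types G (Fin k)) (λ _ → true) → CwAtMost (3 * k) G
  cw-bound irr 1≤n D with realise irr D
  ... | inj₁ none = case none (fromℕ< 1≤n) of λ ()
  ... | inj₂ R = cw-from-permutation (sym (↔⇒≡ σ)) expr σ λ u v → sym
          (trans (ladj-pos (idx u) (idx v)) (cong₂ (adj G) (proj₂ (pos-onto refl)) (proj₂ (pos-onto refl))))
    where
    open Realisation R
    idx : Fin (n G) → Fin order
    idx u = proj₁ (pos-onto {u} refl)
    σ : Permutation (n G) order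
    σ = permutation idx pos (λ i → pos-inj (proj₂ (pos-onto refl))) (λ u → proj₂ (pos-onto refl))

-- Chordal graphs: walks, holes and simplicial vertices

module SimpleGraph (G : Graph) (simple : IsSimple G) where

  V : Set
  V = Fin (n G)

  infix 4 _~_ _≁_
  _~_ _≁_ : V → V → Set
  u ~ v = adj G u v ≡ true
  u ≁ v = adj G u v ≡ false

  ~-sym : ∀ {u v} → u ~ v → v ~ u
  ~-sym {u} {v} = trans (proj₁ simple v u)

  ≁-sym : ∀ {u v} → u ≁ v → v ≁ u
  ≁-sym {u} {v} = trans (proj₁ simple v u)

  ~⇒≢ : ∀ {u v} → u ~ v → u ≢ v
  ~⇒≢ {u} u~u refl = clash u~u (proj₂ simple u)

  ~? : ∀ u v → u ~ v ⊎ u ≁ v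
  ~? u v = bool-cases (adj G u v)

  separates : ∀ {u v w} → u ~ w → v ≁ w → u ≢ v
  separates u~w v≁w refl = clash u~w v≁w

  module HoleFree (chordal : Chordal G) where

    -- Every vertex is nonadjacent to itself, so the two diagonals need inequalities besides
    -- nonadjacency.
    no-C4 : ∀ {a b c d} → a ~ b → b ~ c → c ~ d → d ~ a → a ≁ c → b ≁ d → a ≢ c → b ≢ d → ⊥
    no-C4 {a} {b} {c} {d} ab bc cd da ac bd a≢c b≢d = chordal 4 ≤-refl (f , inj _ _ , hom)
      where
      f : Fin 4 → V
      f 0F = a
      f 1F = b
      f 2F = c
      f 3F = d
      inj : ∀ i j → f i ≡ f j → i ≡ j
      inj 0F 0F _ = refl
      inj 0F 1F e = ⊥-elim (~⇒≢ ab e)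
      inj 0F 2F e = ⊥-elim (a≢c e)
      inj 0F 3F e = ⊥-elim (~⇒≢ da (sym e))
      inj 1F 0F e = ⊥-elim (~⇒≢ ab (sym e))
      inj 1F 1F _ = refl
      inj 1F 2F e = ⊥-elim (~⇒≢ bc e)
      inj 1F 3F e = ⊥-elim (b≢d e)
      inj 2F 0F e = ⊥-elim (a≢c (sym e))
      inj 2F 1F e = ⊥-elim (~⇒≢ bc (sym e))
      inj 2F 2F _ = refl
      inj 2F 3F e = ⊥-elim (~⇒≢ cd e)
      inj 3F 0F e = ⊥-elim (~⇒≢ da e)
      inj 3F 1F e = ⊥-elim (b≢d (sym e))
      inj 3F 2F e = ⊥-elim (~⇒≢ cd (sym e))
      inj 3F 3F _ = refl
      hom : ∀ i j → adj (C 4) i j ≡ adj G (f i) (f j)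
      hom 0F 0F = sym (proj₂ simple a)
      hom 0F 1F = sym ab
      hom 0F 2F = sym ac
      hom 0F 3F = sym (~-sym da)
      hom 1F 0F = sym (~-sym ab)
      hom 1F 1F = sym (proj₂ simple b)
      hom 1F 2F = sym bc
      hom 1F 3F = sym bd
      hom 2F 0F = sym (≁-sym ac)
      hom 2F 1F = sym (~-sym bc)
      hom 2F 2F = sym (proj₂ simple c)
      hom 2F 3F = sym cd
      hom 3F 0F = sym da
      hom 3F 1F = sym (≁-sym bd)
      hom 3F 2F = sym (~-sym cd)
      hom 3F 3F = sym (proj₂ simple d)

    -- Positions are natural numbers and values beyond `len` are immaterial, which makes extending a
    -- walk plain arithmetic.
    record Walk (H : VSet (n G)) (a b : V) : Set where
      field
        len    : ℕ
        at     : ℕ → V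
        start  : at 0 ≡ a
        end    : at len ≡ b
        step   : ∀ i → i < len → at i ~ at (suc i)
        inside : ∀ i → i ≤ len → at i ∈ H

    -- A walk from s to s′ with interior in H has only its ends adjacent to v,
    -- so a chordless one closes to an induced cycle through v.
    module _ (H : VSet (n G)) {s s′ v : V} (s∉H : s ∉ H) (s′∉H : s′ ∉ H) (v∉H : v ∉ H)
             (s≁s′ : s ≁ s′) (s≢s′ : s ≢ s′) (v~s : v ~ s) (v~s′ : v ~ s′)
             (v≁H : ∀ h → h ∈ H → v ≁ h) where

      record Link (ℓ : ℕ) : Set where
        field
          at     : ℕ → V
          start  : at 0 ≡ s
          end    : at ℓ ≡ s′
          step   : ∀ i → i < ℓ → at i ~ at (suc i)
          inside : ∀ i → suc i < ℓ → at (suc i) ∈ H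

      -- Writing the later position as `suc (suc i) + d` encodes that the two positions are not
      -- consecutive and avoids subtraction.
      Chord : ∀ {ℓ} → Link ℓ → ℕ → ℕ → Set
      Chord L i d = Link.at L i ~ Link.at L (suc (suc i) + d)

      shortcut : ∀ {ℓ} (L : Link ℓ) i d e → ℓ ≡ suc (suc i) + d + e → Chord L i d → Link (suc i + e)
      shortcut L i d e refl chord = record
        { at = at′ ; start = start′ ; end = end′ ; step = step′ ; inside = inside′ }
        where
        open Link L
        -- The chord bypasses the `suc d` vertices strictly between its ends, so positions after `i`
        -- are shifted by `suc d`.
        at′ : ℕ → V
        at′ t with t ≤? i
        ... | yes _ = at t
        ... | no  _ = at (t + suc d)
        ≤i : ∀ {t} → t ≤ i → at′ t ≡ at t
        ≤i {t} p with t ≤? i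
        ... | yes _ = refl
        ... | no ¬p = ⊥-elim (¬p p)
        >i : ∀ {t} → i < t → at′ t ≡ at (t + suc d)
        >i {t} p with t ≤? i
        ... | yes q = ⊥-elim (<⇒≱ p q)
        ... | no _ = refl
        shift : ∀ x → i + x + suc d ≡ suc (i + d + x)
        shift x = trans (+-suc (i + x) d) (cong suc (trans (+-assoc i x d) (trans (cong (i +_) (+-comm x d)) (sym (+-assoc i d x)))))
        bound : ∀ {t} → t < suc i + e → t + suc d < suc (suc i) + d + e
        bound {t} p = ≤-trans (+-monoˡ-< (suc d) p) (≤-reflexive (cong suc (shift e)))
        start′ : at′ 0 ≡ s
        start′ = trans (≤i z≤n) start
        end′ : at′ (suc i + e) ≡ s′
        end′ = trans (>i (s≤s (m≤m+n i e))) (trans (cong (λ t → at (suc t)) (shift e)) end)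
        step′ : ∀ t → t < suc i + e → at′ t ~ at′ (suc t)
        step′ t p with <-cmp t i
        ... | tri< t<i _ _ = subst₂ _~_ (sym (≤i (<⇒≤ t<i))) (sym (≤i t<i))
                               (step t (≤-trans t<i (≤-trans (n≤1+n i) (≤-trans (m≤m+n _ d) (≤-trans (n≤1+n _) (m≤m+n _ e))))))
        ... | tri≈ _ refl _ = subst₂ _~_ (sym (≤i ≤-refl))
                               (sym (trans (>i ≤-refl) (cong (λ x → at (suc x)) (+-suc t d)))) chord
        ... | tri> _ _ i<t = subst₂ _~_ (sym (>i i<t)) (sym (>i (m<n⇒m<1+n i<t))) (step (t + suc d) (bound p))
        inside′ : ∀ t → suc t < suc i + e → at′ (suc t) ∈ H
        inside′ t p with suc t ≤? i
        ... | yes q = inside t (≤-trans (s≤s q) (≤-trans (n≤1+n (suc i)) (≤-trans (m≤m+n _ d) (m≤m+n _ e))))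
        ... | no _ = inside (t + suc d) (bound p)

      module Chordless {ℓ} (L : Link ℓ)
               (chordless : ∀ i d → suc (suc i) + d ≤ ℓ → Link.at L i ≁ Link.at L (suc (suc i) + d)) where
        open Link L

        far : ∀ {i j} → suc (suc i) ≤ j → j ≤ ℓ → at i ≁ at j
        far {i} p q with m≤n⇒∃[o]m+o≡n p
        ... | d , refl = chordless i d q

        2≤ℓ : 2 ≤ ℓ
        2≤ℓ = lower ℓ refl
          where
          lower : ∀ k → k ≡ ℓ → 2 ≤ k
          lower 0 refl = ⊥-elim (s≢s′ (trans (sym start) end))
          lower 1 refl = ⊥-elim (clash (subst₂ _~_ start end (step 0 (s≤s z≤n))) s≁s′)
          lower (suc (suc k)) _ = s≤s (s≤s z≤n)

        cyc : ℕ → V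
        cyc t with t ≤? ℓ
        ... | yes _ = at t
        ... | no  _ = v

        cyc-≤ : ∀ {t} → t ≤ ℓ → cyc t ≡ at t
        cyc-≤ {t} p with t ≤? ℓ
        ... | yes _ = refl
        ... | no ¬p = ⊥-elim (¬p p)

        cyc-v : cyc (suc ℓ) ≡ v
        cyc-v with suc ℓ ≤? ℓ
        ... | yes p = ⊥-elim (1+n≰n p)
        ... | no _  = refl

        v~end : v ~ at ℓ
        v~end = subst (v ~_) (sym end) v~s′

        v~start : v ~ at 0
        v~start = subst (v ~_) (sym start) v~s

        v≁mid : ∀ i → 0 < i → i < ℓ → v ≁ at i
        v≁mid (suc i) _ p = v≁H _ (inside i p)

        -- The `suc ℓ` vertices of the link together with `v`; `2≤ℓ` makes this at least 4.
        r : ℕ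
        r = suc (suc ℓ)

        Cyc : ℕ → ℕ → Set
        Cyc i j = (suc i ≡ j) ⊎ (i ≡ 0 × suc j ≡ r)

        -- The adjacency of `C r` on natural numbers, so that the cycle can be analysed before
        -- passing to `Fin r`.
        cadj : ℕ → ℕ → Bool
        cadj i j = ((suc i ≡ᵇ j) ∨ (suc j ≡ᵇ i)) ∨ ((i ≡ᵇ 0) ∧ (suc j ≡ᵇ r)) ∨ ((j ≡ᵇ 0) ∧ (suc i ≡ᵇ r))

        ≡ᵇ⁻ : ∀ a b → (a ≡ᵇ b) ≡ true → a ≡ b
        ≡ᵇ⁻ a b h = ≡ᵇ⇒≡ a b (Equivalence.from T-≡ h)

        ≡ᵇ⁺ : ∀ {a b} → a ≡ b → (a ≡ᵇ b) ≡ true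
        ≡ᵇ⁺ {a} {b} h = Equivalence.to T-≡ (≡⇒≡ᵇ a b h)

        cadj⁻ : ∀ {i j} → cadj i j ≡ true → Cyc i j ⊎ Cyc j i
        cadj⁻ {i} {j} h with ∨-true⁻ h
        ... | inj₁ p with ∨-true⁻ p
        ...   | inj₁ q = inj₁ (inj₁ (≡ᵇ⁻ (suc i) j q))
        ...   | inj₂ q = inj₂ (inj₁ (≡ᵇ⁻ (suc j) i q))
        cadj⁻ {i} {j} h | inj₂ p with ∨-true⁻ {(i ≡ᵇ 0) ∧ (suc j ≡ᵇ r)} p
        ...   | inj₁ q = let a , b = ∧-true⁻ q in inj₁ (inj₂ (≡ᵇ⁻ i 0 a , ≡ᵇ⁻ (suc j) r b))
        ...   | inj₂ q = let a , b = ∧-true⁻ q in inj₂ (inj₂ (≡ᵇ⁻ j 0 a , ≡ᵇ⁻ (suc i) r b))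

        cadj⁺ : ∀ {i j} → Cyc i j ⊎ Cyc j i → cadj i j ≡ true
        cadj⁺ {i} {j} (inj₁ (inj₁ p)) = ∨-trueˡ _ (∨-trueˡ _ (≡ᵇ⁺ p))
        cadj⁺ {i} {j} (inj₁ (inj₂ (p , q))) = ∨-trueʳ ((suc i ≡ᵇ j) ∨ (suc j ≡ᵇ i)) (∨-trueˡ _ (cong₂ _∧_ (≡ᵇ⁺ p) (≡ᵇ⁺ q)))
        cadj⁺ {i} {j} (inj₂ (inj₁ p)) = ∨-trueˡ _ (∨-trueʳ (suc i ≡ᵇ j) (≡ᵇ⁺ p))
        cadj⁺ {i} {j} (inj₂ (inj₂ (p , q))) = ∨-trueʳ ((suc i ≡ᵇ j) ∨ (suc j ≡ᵇ i))
          (∨-trueʳ ((i ≡ᵇ 0) ∧ (suc j ≡ᵇ r)) (cong₂ _∧_ (≡ᵇ⁺ p) (≡ᵇ⁺ q)))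

        data Bound : ℕ → Set where
          on-link : ∀ {j} → j ≤ ℓ → Bound j
          at-v    : Bound (suc ℓ)

        bound : ∀ {j} → j < r → Bound j
        bound {j} (s≤s p) with m≤n⇒m<n∨m≡n p
        ... | inj₁ (s≤s q) = on-link q
        ... | inj₂ refl = at-v

        cyc⁺ : ∀ {i j} → i < r → j < r → Cyc i j → cyc i ~ cyc j
        cyc⁺ {i} p q (inj₁ refl) with bound q
        ... | on-link j≤ℓ = subst₂ _~_ (sym (cyc-≤ (<⇒≤ j≤ℓ))) (sym (cyc-≤ j≤ℓ)) (step i j≤ℓ)
        ... | at-v = subst₂ _~_ (sym (cyc-≤ ≤-refl)) (sym cyc-v) (~-sym v~end)
        cyc⁺ p q (inj₂ (refl , refl)) = subst₂ _~_ (sym (cyc-≤ z≤n)) (sym cyc-v) (~-sym v~start)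

        cyc⁻ : ∀ {i j} → i < j → j < r → cyc i ~ cyc j → Cyc i j
        cyc⁻ {i} {j} i<j q h with bound q
        ... | on-link j≤ℓ with m≤n⇒m<n∨m≡n i<j
        ...   | inj₂ e = inj₁ e
        ...   | inj₁ p = ⊥-elim (clash (subst₂ _~_ (cyc-≤ (≤-trans (<⇒≤ i<j) j≤ℓ)) (cyc-≤ j≤ℓ) h) (far p j≤ℓ))
        cyc⁻ {zero} {j} i<j q h | at-v = inj₂ (refl , refl)
        cyc⁻ {suc i} {j} (s≤s i<ℓ) q h | at-v with m≤n⇒m<n∨m≡n i<ℓ
        ...   | inj₂ refl = inj₁ refl
        ...   | inj₁ p = ⊥-elim (clash (~-sym (subst₂ _~_ (cyc-≤ i<ℓ) cyc-v h)) (v≁mid (suc i) (s≤s z≤n) p))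

        -- A link may repeat vertices, but a chordless one cannot: if positions i < j < ℓ carried
        -- the same vertex, position i would be adjacent to position j + 1, a chord. A repetition of
        -- the last vertex is excluded by `s≢s′` or because `s′` is not in `H`.
        cyc-inj : ∀ {i j} → i < j → j < r → cyc i ≢ cyc j
        cyc-inj {i} {j} i<j q e with bound q
        cyc-inj {zero} {j} i<j q e | at-v = ~⇒≢ v~start (trans (sym cyc-v) (trans (sym e) (cyc-≤ z≤n)))
        cyc-inj {suc i} {j} (s≤s i<ℓ) q e | at-v with m≤n⇒m<n∨m≡n i<ℓ
        ...   | inj₂ refl = ~⇒≢ v~end (trans (sym cyc-v) (trans (sym e) (cyc-≤ ≤-refl)))
        ...   | inj₁ p = clash (subst (_∈ H) (trans (sym (cyc-≤ i<ℓ)) (trans e cyc-v)) (inside i p)) v∉H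
        cyc-inj {i} {j} i<j q e | on-link j≤ℓ with m≤n⇒m<n∨m≡n j≤ℓ
        ... | inj₁ j<ℓ = clash (step j j<ℓ) (subst (_≁ at (suc j)) e′ (far (s≤s i<j) j<ℓ))
          where e′ = trans (sym (cyc-≤ (≤-trans (<⇒≤ i<j) j≤ℓ))) (trans e (cyc-≤ j≤ℓ))
        cyc-inj {zero} {j} i<j q e | on-link j≤ℓ | inj₂ refl =
          s≢s′ (trans (sym start) (trans (sym (cyc-≤ z≤n)) (trans e (trans (cyc-≤ ≤-refl) end))))
        cyc-inj {suc i} {j} i<j q e | on-link j≤ℓ | inj₂ refl =
          clash (subst (_∈ H) (trans (sym (cyc-≤ (<⇒≤ i<j))) (trans e (trans (cyc-≤ ≤-refl) end))) (inside i i<j)) s′∉H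

        impossible : ⊥
        impossible = chordal r (s≤s (s≤s 2≤ℓ)) (f , (λ {i} {j} → inj i j) , hom)
          where
          f : Fin r → V
          f i = cyc (toℕ i)
          inj : ∀ i j → f i ≡ f j → i ≡ j
          inj i j e with <-cmp (toℕ i) (toℕ j)
          ... | tri< p _ _ = ⊥-elim (cyc-inj p (toℕ<n j) e)
          ... | tri≈ _ p _ = toℕ-injective p
          ... | tri> _ _ p = ⊥-elim (cyc-inj p (toℕ<n i) (sym e))
          hom : ∀ i j → cadj (toℕ i) (toℕ j) ≡ adj G (f i) (f j)
          hom i j = ≡-from-⇔ to from
            where
            to : cadj (toℕ i) (toℕ j) ≡ true → f i ~ f j
            to h with cadj⁻ {toℕ i} {toℕ j} h
            ... | inj₁ p = cyc⁺ (toℕ<n i) (toℕ<n j) p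
            ... | inj₂ p = ~-sym (cyc⁺ (toℕ<n j) (toℕ<n i) p)
            from : f i ~ f j → cadj (toℕ i) (toℕ j) ≡ true
            from h with <-cmp (toℕ i) (toℕ j)
            ... | tri< p _ _ = cadj⁺ {toℕ i} {toℕ j} (inj₁ (cyc⁻ p (toℕ<n j) h))
            ... | tri≈ _ p _ = ⊥-elim (~⇒≢ h (cong cyc p))
            ... | tri> _ _ p = cadj⁺ {toℕ i} {toℕ j} (inj₂ (cyc⁻ p (toℕ<n i) (~-sym h)))

      -- A chord gives a strictly shorter link, so descent on the length ends at a chordless one,
      -- which closes to a hole.
      no-link : ∀ b ℓ → ℓ < b → ¬ Link ℓ
      no-link (suc b) ℓ (s≤s ℓ≤b) L
        with anyUpTo? (λ i → anyUpTo? (λ d → (suc (suc i) + d ≤? ℓ) ×-dec (adj G (Link.at L i) (Link.at L (suc (suc i) + d)) ≟ true)) ℓ) ℓ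
      ... | no ¬ch = Chordless.impossible L λ i d p → ≢true⇒≡false λ ch →
              ¬ch (i , ≤-trans (n≤1+n _) (≤-trans (m≤m+n _ d) p) , d , ≤-trans (s≤s (m≤n+m d (suc i))) p , p , ch)
      ... | yes (i , _ , d , _ , p , ch) with m≤n⇒∃[o]m+o≡n p
      ...   | e , refl = no-link b (suc i + e) (≤-trans (s≤s (s≤s (+-monoˡ-≤ e (m≤m+n i d)))) ℓ≤b)
                           (shortcut L i d e refl ch)

      no-detour : ∀ {h h′} → Walk H h h′ → s ~ h → s′ ~ h′ → ⊥
      no-detour {h} {h′} W s~h s′~h′ = no-link _ (suc (suc len)) ≤-refl (record
        { at = at′ ; start = refl ; end = end′ ; step = step′ ; inside = inside′ })
        where
        open Walk W
        at′ : ℕ → V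
        at′ zero = s
        at′ (suc t) with t ≤? len
        ... | yes _ = at t
        ... | no _ = s′
        mid : ∀ {t} → t ≤ len → at′ (suc t) ≡ at t
        mid {t} p with t ≤? len
        ... | yes _ = refl
        ... | no ¬p = ⊥-elim (¬p p)
        end′ : at′ (suc (suc len)) ≡ s′
        end′ with suc len ≤? len
        ... | yes p = ⊥-elim (1+n≰n p)
        ... | no _ = refl
        step′ : ∀ i → i < suc (suc len) → at′ i ~ at′ (suc i)
        step′ zero _ = subst (s ~_) (sym (trans (mid z≤n) start)) s~h
        step′ (suc i) (s≤s (s≤s p)) with m≤n⇒m<n∨m≡n p
        ... | inj₁ q = subst₂ _~_ (sym (mid p)) (sym (mid q)) (step i q)
        ... | inj₂ refl = subst₂ _~_ (sym (trans (mid p) end)) (sym end′) (~-sym s′~h′)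
        inside′ : ∀ i → suc i < suc (suc len) → at′ (suc i) ∈ H
        inside′ i (s≤s (s≤s p)) = subst (_∈ H) (sym (mid p)) (inside i p)

    module _ {H H′ : VSet (n G)} (H⊆H′ : ∀ x → x ∈ H → x ∈ H′) where

      walk-⊆ : ∀ {a b} → Walk H a b → Walk H′ a b
      walk-⊆ W = record
        { len = len ; at = at ; start = start ; end = end ; step = step
        ; inside = λ i p → H⊆H′ _ (inside i p) }
        where open Walk W

      walk-cons : ∀ {s a b} → s ∈ H′ → s ~ a → Walk H a b → Walk H′ s b
      walk-cons {s} s∈H′ s~a W = record
        { len = suc len ; at = λ { zero → s ; (suc t) → at t } ; start = refl ; end = end
        ; step = λ { zero _ → subst (s ~_) (sym start) s~a ; (suc i) (s≤s p) → step i p }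
        ; inside = λ { zero _ → s∈H′ ; (suc i) (s≤s p) → H⊆H′ _ (inside i p) } }
        where open Walk W

      walk-snoc : ∀ {s a b} → s ∈ H′ → s ~ b → Walk H a b → Walk H′ a s
      walk-snoc {s} s∈H′ s~b W = record
        { len = suc len ; at = at′ ; start = trans (before z≤n) start ; end = after
        ; step = step′ ; inside = inside′ }
        where
        open Walk W
        at′ : ℕ → V
        at′ t with t ≤? len
        ... | yes _ = at t
        ... | no _  = s
        before : ∀ {t} → t ≤ len → at′ t ≡ at t
        before {t} p with t ≤? len
        ... | yes _ = refl
        ... | no ¬p = ⊥-elim (¬p p)
        after : at′ (suc len) ≡ s
        after with suc len ≤? len
        ... | yes p = ⊥-elim (1+n≰n p)
        ... | no _  = refl
        step′ : ∀ i → i < suc len → at′ i ~ at′ (suc i)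
        step′ i (s≤s p) with m≤n⇒m<n∨m≡n p
        ... | inj₁ q    = subst₂ _~_ (sym (before p)) (sym (before q)) (step i q)
        ... | inj₂ refl = subst₂ _~_ (sym (trans (before p) end)) (sym after) (~-sym s~b)
        inside′ : ∀ i → i ≤ suc len → at′ i ∈ H′
        inside′ i p with m≤n⇒m<n∨m≡n p
        ... | inj₁ (s≤s q) = subst (_∈ H′) (sym (before q)) (H⊆H′ _ (inside i q))
        ... | inj₂ refl    = subst (_∈ H′) (sym after) s∈H′

    Connected : VSet (n G) → Set
    Connected H = ∀ {a b} → a ∈ H → b ∈ H → Walk H a b

    insert : V → VSet (n G) → VSet (n G)
    insert s H x = H x ∨ eq? x s

    insert-⊆ : ∀ s H x → x ∈ H → x ∈ insert s H
    insert-⊆ s H x = ∨-trueˡ _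

    ∈-insert : ∀ s H → s ∈ insert s H
    ∈-insert s H = ∨-trueʳ (H s) (eq?-refl s)

    insert⁻ : ∀ s H {x} → x ∈ insert s H → x ∈ H ⊎ x ≡ s
    insert⁻ s H {x} h with ∨-true⁻ {H x} h
    ... | inj₁ x∈H = inj₁ x∈H
    ... | inj₂ x=s = inj₂ (eq?⁻ x=s)

    connected-insert : ∀ {s h H} → s ~ h → h ∈ H → Connected H → Connected (insert s H)
    connected-insert {s} {h} {H} s~h h∈H conn a∈ b∈ with insert⁻ s H a∈ | insert⁻ s H b∈
    ... | inj₁ a∈H  | inj₁ b∈H  = walk-⊆ (insert-⊆ s H) (conn a∈H b∈H)
    ... | inj₁ a∈H  | inj₂ refl = walk-snoc (insert-⊆ s H) (∈-insert s H) s~h (conn a∈H h∈H)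
    ... | inj₂ refl | inj₁ b∈H  = walk-cons (insert-⊆ s H) (∈-insert s H) s~h (conn h∈H b∈H)
    ... | inj₂ refl | inj₂ refl = record
      { len = 0 ; at = λ _ → s ; start = refl ; end = refl ; step = λ _ () ; inside = λ _ _ → ∈-insert s H }

    Simplicial : VSet (n G) → V → Set
    Simplicial U v = ∀ {x y} → x ∈ U → y ∈ U → v ~ x → v ~ y → x ≢ y → x ~ y

    module Grow (U : VSet (n G))
      (smaller : ∀ U′ → size U′ < size U → ∃ (_∈ U′) → ∃ λ v → v ∈ U′ × Simplicial U′ v) where

      Remote Attached : VSet (n G) → V → Set
      Remote   H r = r ∈ U × r ∉ H × (∀ h → h ∈ H → r ≁ h)
      Attached H s = s ∈ U × s ∉ H × ∃ λ h → h ∈ H × s ~ h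

      remote? : ∀ H → Decidable (Remote H)
      remote? H r = (U r ≟ true) ×-dec (H r ≟ false) ×-dec
        all? λ h → (H h ≟ true) →-dec (adj G r h ≟ false)

      attached? : ∀ H → Decidable (Attached H)
      attached? H s = (U s ≟ true) ×-dec (H s ≟ false) ×-dec
        any? λ h → (H h ≟ true) ×-dec (adj G s h ≟ true)

      rest : VSet (n G) → VSet (n G)
      rest H x = U x ∧ not (H x)

      ∈-rest : ∀ {H x} → x ∈ U → x ∉ H → x ∈ rest H
      ∈-rest x∈U x∉H = cong₂ (λ a b → a ∧ not b) x∈U x∉H

      rest⁻ : ∀ {H x} → x ∈ rest H → x ∈ U × x ∉ H
      rest⁻ {H} {x} h with ∧-true⁻ {U x} h
      ... | p , q = p , not-injective q

      -- When H cannot grow, N(H) is complete to the remote vertices and, having no hole, a clique,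
      -- so a vertex simplicial among the remote ones is simplicial in U.
      stuck : ∀ {H x} → x ∈ U → x ∈ H → Connected H → ∃ (Remote H) →
              (∀ s r → Attached H s → Remote H r → s ~ r) → ∃ λ v → v ∈ U × Simplicial U v
      stuck {H} {x} x∈U x∈H conn (r , rem) full
        with smaller R (size-< x (λ y y∈R → proj₁ (R⁻ y∈R)) x∈U
               (dec-false (remote? H x) λ (_ , x∉H , _) → clash x∈H x∉H))
             (r , dec-true (remote? H r) rem)
        where
        R : VSet (n G)
        R y = does (remote? H y)
        R⁻ : ∀ {y} → y ∈ R → Remote H y
        R⁻ {y} = does⁻ (remote? H y)
      ... | v , v∈R , simp with does⁻ (remote? H v) v∈R
      ...   | v∈U , v∉H , v≁H = v , v∈U , λ {a} {b} → go {a} {b}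
        where
        side : ∀ {a} → a ∈ U → v ~ a → Remote H a ⊎ Attached H a
        side {a} a∈U v~a with remote? H a | attached? H a
        ... | yes p | _ = inj₁ p
        ... | _ | yes p = inj₂ p
        ... | no ¬p | no ¬q with bool-cases (H a)
        ...   | inj₁ a∈H = ⊥-elim (clash v~a (v≁H a a∈H))
        ...   | inj₂ a∉H = ⊥-elim (¬p (a∈U , a∉H , λ h h∈H → ≢true⇒≡false λ a~h → ¬q (a∈U , a∉H , h , h∈H , a~h)))
        go : Simplicial U v
        go {a} {b} a∈U b∈U v~a v~b a≢b with side a∈U v~a | side b∈U v~b
        ... | inj₁ p | inj₁ q = simp (dec-true (remote? H a) p) (dec-true (remote? H b) q) v~a v~b a≢b
        ... | inj₁ p | inj₂ q = ~-sym (full b a q p)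
        ... | inj₂ p | inj₁ q = full a b p q
        ... | inj₂ (_ , a∉H , h , h∈H , a~h) | inj₂ (_ , b∉H , h′ , h′∈H , b~h′) with ~? a b
        ...   | inj₁ a~b = a~b
        ...   | inj₂ a≁b = ⊥-elim (no-detour H a∉H b∉H v∉H a≁b a≢b v~a v~b v≁H (conn h∈H h′∈H) a~h b~h′)

      -- Only an attached vertex that misses some remote `r` is absorbed. This `r` stays remote, so
      -- there is still a remote vertex for the induction hypothesis once no further growth is
      -- possible.
      grow : ∀ b H → size (rest H) < b → ∀ {x} → x ∈ U → x ∈ H → Connected H → ∃ (Remote H) →
             ∃ λ v → v ∈ U × Simplicial U v
      grow (suc b) H (s≤s p) x∈U x∈H conn rem
        with any? (λ s → attached? H s ×-dec any? λ r → remote? H r ×-dec (adj G s r ≟ false))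
      ... | no ¬ex = stuck x∈U x∈H conn rem λ s r att rem′ →
              case ~? s r of λ { (inj₁ h) → h ; (inj₂ h) → ⊥-elim (¬ex (s , att , r , rem′ , h)) }
      ... | yes (s , (s∈U , s∉H , h , h∈H , s~h) , r , (r∈U , r∉H , r≁H) , s≁r) =
              grow b (insert s H) (≤-trans shrink p) x∈U (insert-⊆ s H _ x∈H)
                (connected-insert s~h h∈H conn)
                (r , r∈U , trans (cong (_∨ eq? r s) r∉H) (eq?-≢ r≢s) , λ y y∈ → case insert⁻ s H y∈ of λ
                  { (inj₁ y∈H) → r≁H y y∈H ; (inj₂ refl) → ≁-sym s≁r })
        where
        r≢s : r ≢ s
        r≢s refl = clash s~h (r≁H h h∈H)
        shrink : size (rest (insert s H)) < size (rest H)
        shrink = size-< s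
          (λ y y∈ → let y∈U , y∉ = rest⁻ {insert s H} y∈ in ∈-rest {H} y∈U (proj₁ (∨-false⁻ y∉)))
          (∈-rest {H} s∈U s∉H)
          (trans (cong (λ b → U s ∧ not b) (∈-insert s H)) (∧-zeroʳ (U s)))

    -- In a clique any vertex will do. Otherwise growth starts from one of two nonadjacent vertices,
    -- the other being remote.
    simplicial-< : ∀ b U → size U < b → ∃ (_∈ U) → ∃ λ v → v ∈ U × Simplicial U v
    simplicial-< (suc b) U (s≤s p) (u , u∈U)
      with any? (λ x → (U x ≟ true) ×-dec any? λ y → (U y ≟ true) ×-dec ¬? (y ≟ᶠ x) ×-dec (adj G y x ≟ false))
    ... | no ¬ex = u , u∈U , λ {x} {y} x∈U y∈U _ _ x≢y → case ~? x y of λ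
            { (inj₁ h) → h ; (inj₂ h) → ⊥-elim (¬ex (y , y∈U , x , x∈U , x≢y , h)) }
    ... | yes (x , x∈U , y , y∈U , y≢x , y≁x) =
            Grow.grow U (λ U′ q → simplicial-< b U′ (≤-trans q p)) _ (λ z → eq? z x) ≤-refl x∈U (eq?-refl x)
              (λ a b → record { len = 0 ; at = λ _ → x ; start = sym (eq?⁻ a) ; end = sym (eq?⁻ b)
                              ; step = λ _ () ; inside = λ _ _ → eq?-refl x })
              (y , y∈U , eq?-≢ y≢x , λ h h=x → subst (y ≁_) (sym (eq?⁻ h=x)) y≁x)

    simplicial : ∀ U → ∃ (_∈ U) → ∃ λ v → v ∈ U × Simplicial U v
    simplicial U = simplicial-< _ U ≤-refl

    -- Decomposing paw-free chordal graphs

    PawFree : VSet (n G) → Set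
    PawFree U = ∀ {c a b p} → c ∈ U → a ∈ U → b ∈ U → p ∈ U →
                c ~ a → c ~ b → a ~ b → c ~ p → p ~ a ⊎ p ~ b

    -- One class of vertices with outside neighbours: rank-width at most one.
    Uniform : VSet (n G) → VSet (n G) → Set
    Uniform U S = Σ (VSet (n G)) λ active →
      (∀ {u w} → u ∈ S → u ∉ active → w ∈ U → w ∉ S → u ≁ w) ×
      (∀ {u u′ w} → u ∈ S → u′ ∈ S → u ∈ active → u′ ∈ active → w ∈ U → w ∉ S → adj G u w ≡ adj G u′ w)

    uniform-full : ∀ U → Uniform U U
    uniform-full U = (λ _ → true) , (λ _ ()) , λ _ _ _ _ w∈U w∉U → ⊥-elim (clash w∈U w∉U)

    uniform-singleton : ∀ U S a → (∀ x → x ∈ S → x ≡ a) → Uniform U S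
    uniform-singleton U S a only = (λ _ → true) , (λ _ ()) ,
      λ {u} {u′} {w} u∈S u′∈S _ _ _ _ → cong (λ t → adj G t w) (trans (only u u∈S) (sym (only u′ u′∈S)))

    module Insertion (U : VSet (n G)) (x p : V) (p∈U : p ∈ U) (p≢x : p ≢ x) where

      -- The vertex `x` follows `p`: it joins every set of the old tree that contains `p`, so no cut
      -- inherited from that tree separates the two.
      beside : VSet (n G) → VSet (n G)
      beside S y = S y ∨ (eq? y x ∧ S p)

      beside⁻ : ∀ S {y} → y ∈ beside S → y ∈ S ⊎ (y ≡ x × p ∈ S)
      beside⁻ S {y} h with ∨-true⁻ {S y} h
      ... | inj₁ y∈S = inj₁ y∈S
      ... | inj₂ h′ = let a , b = ∧-true⁻ h′ in inj₂ (eq?⁻ a , b)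

      ∉-beside⁻ : ∀ S → x ∉ beside S → p ∉ S
      ∉-beside⁻ S h = subst (λ b → b ∧ S p ≡ false) (eq?-refl x) (proj₂ (∨-false⁻ {S x} h))

      x∉ : ∀ {S} → S ⊑ (U - x) → x ∉ S
      x∉ S⊆ = ≢true⇒≡false λ x∈S → clash (S⊆ x x∈S) (∉-delete U x)

      module _ (twin : ∀ {w} → w ∈ U - x → w ≢ p → adj G w x ≡ adj G w p) where

        rep : V → V
        rep y = if eq? y x then p else y

        rep-x : rep x ≡ p
        rep-x = cong (if_then p else x) (eq?-refl x)

        rep-≢ : ∀ {y} → y ≢ x → rep y ≡ y
        rep-≢ {y} y≢x = cong (if_then p else y) (eq?-≢ y≢x)

        -- Across the cut, `x` can be replaced by `p` on whichever side it lies. As `x` and `p` are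
        -- on the same side, their mutual adjacency never matters, and true and false twins are
        -- treated alike.
        beside-twin : ∀ {S} → S ⊑ (U - x) → Uniform (U - x) S → Uniform U (beside S)
        beside-twin {S} S⊆ (active , inert , alike) =
            (λ y → active (rep y))
          , (λ {u} {w} u∈ a w∈U w∉ → trans (adj-rep u∈ w∈U w∉) (inert (rep-∈ u∈) a (rep-∈U w∈U w∉) (rep-∉ w∉)))
          , λ {u} {u′} {w} u∈ u′∈ a a′ w∈U w∉ → trans (adj-rep u∈ w∈U w∉)
              (trans (alike (rep-∈ u∈) (rep-∈ u′∈) a a′ (rep-∈U w∈U w∉) (rep-∉ w∉)) (sym (adj-rep u′∈ w∈U w∉)))
          where
          S≢x : ∀ {y} → y ∈ S → y ≢ x
          S≢x y∈S refl = clash y∈S (x∉ S⊆)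
          rep-∈ : ∀ {u} → u ∈ beside S → rep u ∈ S
          rep-∈ u∈ with beside⁻ S u∈
          ... | inj₁ u∈S = subst (_∈ S) (sym (rep-≢ (S≢x u∈S))) u∈S
          ... | inj₂ (refl , p∈S) = subst (_∈ S) (sym rep-x) p∈S
          rep-∉ : ∀ {w} → w ∉ beside S → rep w ∉ S
          rep-∉ {w} w∉ with ≡? w x
          ... | yes refl = subst (_∉ S) (sym rep-x) (∉-beside⁻ S w∉)
          ... | no w≢x = subst (_∉ S) (sym (rep-≢ w≢x)) (proj₁ (∨-false⁻ w∉))
          rep-∈U : ∀ {w} → w ∈ U → w ∉ beside S → rep w ∈ U - x
          rep-∈U {w} w∈U w∉ with ≡? w x
          ... | yes refl = subst (_∈ U - x) (sym rep-x) (∈-delete⁺ U p∈U p≢x)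
          ... | no w≢x = subst (_∈ U - x) (sym (rep-≢ w≢x)) (∈-delete⁺ U w∈U w≢x)
          adj-rep : ∀ {u w} → u ∈ beside S → w ∈ U → w ∉ beside S → adj G u w ≡ adj G (rep u) (rep w)
          adj-rep {u} {w} u∈ w∈U w∉ with ≡? u x | ≡? w x
          ... | yes refl | yes refl = ⊥-elim (clash u∈ w∉)
          ... | no u≢x | no w≢x = sym (cong₂ (adj G) (rep-≢ u≢x) (rep-≢ w≢x))
          ... | no u≢x | yes refl with beside⁻ S u∈
          ...   | inj₂ (u≡x , _) = ⊥-elim (u≢x u≡x)
          ...   | inj₁ u∈S = trans (twin (S⊆ u u∈S) λ { refl → clash u∈S (∉-beside⁻ S w∉) })
                    (sym (cong₂ (adj G) (rep-≢ u≢x) rep-x))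
          adj-rep {u} {w} u∈ w∈U w∉ | yes refl | no w≢x with beside⁻ S u∈
          ... | inj₁ x∈S = ⊥-elim (S≢x x∈S refl)
          ... | inj₂ (_ , p∈S) = trans (proj₁ simple x w) (trans
                  (twin (∈-delete⁺ U w∈U w≢x) λ { refl → clash p∈S (proj₁ (∨-false⁻ w∉)) })
                  (trans (proj₁ simple w p) (sym (cong₂ (adj G) rep-x (rep-≢ w≢x)))))

      module _ (pendant : ∀ {w} → w ∈ U - x → w ≢ p → w ≁ x) where

        -- The only possible neighbour of `x` is `p`, on the same side of the cut. Hence `x` is
        -- inactive when inside, and invisible from `S` when outside.
        beside-pendant : ∀ {S} → S ⊑ (U - x) → Uniform (U - x) S → Uniform U (beside S)
        beside-pendant {S} S⊆ (active , inert , alike) = (active - x)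
          , (λ {u} {w} u∈ a w∈U w∉ → inert′ a w∈U w∉ (beside⁻ S u∈))
          , λ {u} {u′} {w} u∈ u′∈ a a′ w∈U w∉ →
              alike′ (∈-delete⁻ active a) (∈-delete⁻ active a′) w∈U w∉ (beside⁻ S u∈) (beside⁻ S u′∈)
          where
          ≁x : ∀ {u} → u ∈ S → x ∉ beside S → u ≁ x
          ≁x u∈S x∉b = pendant (S⊆ _ u∈S) λ { refl → clash u∈S (∉-beside⁻ S x∉b) }
          inert′ : ∀ {u w} → u ∉ active - x → w ∈ U → w ∉ beside S → u ∈ S ⊎ (u ≡ x × p ∈ S) → u ≁ w
          inert′ {u} {w} a w∈U w∉ m with ≡? w x | m
          ... | yes refl | inj₁ u∈S = ≁x u∈S w∉
          ... | yes refl | inj₂ (refl , _) = proj₂ simple x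
          ... | no w≢x | inj₂ (refl , p∈S) =
                ≁-sym (pendant (∈-delete⁺ U w∈U w≢x) λ { refl → clash p∈S (proj₁ (∨-false⁻ w∉)) })
          ... | no w≢x | inj₁ u∈S = inert u∈S
                (≢true⇒≡false λ u∈a → clash (∈-delete⁺ active u∈a λ { refl → clash u∈S (x∉ S⊆) }) a)
                (∈-delete⁺ U w∈U w≢x) (proj₁ (∨-false⁻ w∉))
          alike′ : ∀ {u u′ w} → u ∈ active × u ≢ x → u′ ∈ active × u′ ≢ x → w ∈ U → w ∉ beside S →
                   u ∈ S ⊎ (u ≡ x × p ∈ S) → u′ ∈ S ⊎ (u′ ≡ x × p ∈ S) → adj G u w ≡ adj G u′ w
          alike′ (_ , u≢x) _ _ _ (inj₂ (u≡x , _)) _ = ⊥-elim (u≢x u≡x)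
          alike′ _ (_ , u≢x) _ _ _ (inj₂ (u≡x , _)) = ⊥-elim (u≢x u≡x)
          alike′ {w = w} (a , _) (a′ , _) w∈U w∉ (inj₁ u∈S) (inj₁ u′∈S) with ≡? w x
          ... | yes refl = trans (≁x u∈S w∉) (sym (≁x u′∈S w∉))
          ... | no w≢x = alike u∈S u′∈S a a′ (∈-delete⁺ U w∈U w≢x) (proj₁ (∨-false⁻ w∉))

      beside-decomp : (∀ {S} → S ⊑ (U - x) → Uniform (U - x) S → Uniform U (beside S)) →
                      ∀ {S} → S ⊑ (U - x) → Decomp (Uniform (U - x)) S → Decomp (Uniform U) (beside S)
      beside-decomp lift S⊆ (empty none) =
        empty λ y → cong₂ _∨_ (none y) (trans (cong (eq? y x ∧_) (none p)) (∧-zeroʳ _))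
      beside-decomp lift {S} S⊆ (leaf a a∈S only) with a ≟ᶠ p
      ... | no a≢p = leaf a (∨-trueˡ _ a∈S) λ y y∈ → case beside⁻ S y∈ of λ
              { (inj₁ y∈S) → only y y∈S ; (inj₂ (_ , p∈S)) → ⊥-elim (a≢p (sym (only p p∈S))) }
      -- The old leaf `p` opens into two leaves, `p` and `x`.
      ... | yes refl = node S (λ y → eq? y x ∧ S a) (λ _ → refl)
              (λ y y∈S → cong (_∧ S a) (eq?-≢ λ { refl → clash y∈S (x∉ S⊆) }))
              (lift S⊆ (uniform-singleton (U - x) S a only)) (leaf a a∈S only)
              (leaf x (cong₂ _∧_ (eq?-refl x) a∈S) λ y y∈ → eq?⁻ (proj₁ (∧-true⁻ y∈)))
      beside-decomp lift {S} S⊆ (node A B S=A∪B A∩B=∅ q a b) = node (beside A) (beside B) union′ disjoint (lift S⊆ q)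
        (beside-decomp lift A⊆ a) (beside-decomp lift B⊆ b)
        where
        A⊆ : A ⊑ (U - x)
        A⊆ y y∈A = S⊆ y (trans (S=A∪B y) (∨-trueˡ _ y∈A))
        B⊆ : B ⊑ (U - x)
        B⊆ y y∈B = S⊆ y (trans (S=A∪B y) (∨-trueʳ (A y) y∈B))
        union′ : ∀ y → beside S y ≡ beside A y ∨ beside B y
        union′ y rewrite S=A∪B y | S=A∪B p with A y | B y | eq? y x | A p
        ... | true  | _     | _     | _     = refl
        ... | false | true  | true  | true  = refl
        ... | false | true  | true  | false = refl
        ... | false | true  | false | _     = refl
        ... | false | false | true  | true  = refl
        ... | false | false | true  | false = refl
        ... | false | false | false | _     = refl
        disjoint : ∀ y → y ∈ beside A → y ∉ beside B
        disjoint y y∈ with beside⁻ A y∈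
        ... | inj₂ (refl , p∈A) = cong₂ _∨_ (x∉ B⊆) (trans (cong (eq? x x ∧_) (A∩B=∅ p p∈A)) (∧-zeroʳ _))
        ... | inj₁ y∈A = cong₂ _∨_ (A∩B=∅ y y∈A) (cong (_∧ B p) (eq?-≢ λ { refl → clash y∈A (x∉ A⊆) }))

      beside-all : x ∈ U → ∀ y → beside (U - x) y ≡ U y
      beside-all x∈U y = ≡-from-⇔ to from
        where
        to : y ∈ beside (U - x) → y ∈ U
        to h with beside⁻ (U - x) h
        ... | inj₁ y∈ = proj₁ (∈-delete⁻ U y∈)
        ... | inj₂ (refl , _) = x∈U
        from : y ∈ U → y ∈ beside (U - x)
        from y∈U with y ≟ᶠ x
        ... | yes refl = ∨-trueʳ (U y ∧ _) (∈-delete⁺ U p∈U p≢x)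
        ... | no y≢x = ∨-trueˡ _ (trans (∧-identityʳ _) y∈U)

      extend : x ∈ U → (∀ {S} → S ⊑ (U - x) → Uniform (U - x) S → Uniform U (beside S)) →
               Decomp (Uniform (U - x)) (U - x) → Decomp (Uniform U) U
      extend x∈U lift D = decomp-≐ (beside-all x∈U) (uniform-full U) (beside-decomp lift (λ _ y∈ → y∈) D)

    -- The number of neighbours of a simplicial vertex decides: with none it is isolated, with one
    -- it is pendant, and any two neighbours are twins.
    paw-free-decomp-< : ∀ b U → size U < b → PawFree U → Decomp (Uniform U) U
    paw-free-decomp-< (suc b) U (s≤s size≤b) paw-free with any? (λ x → U x ≟ true)
    ... | no none = empty λ x → ≢true⇒≡false λ x∈U → none (x , x∈U)
    ... | yes some with simplicial U some
    ...   | v , v∈U , simp = branch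
      where
      smaller : ∀ x → x ∈ U → Decomp (Uniform (U - x)) (U - x)
      smaller x x∈U = paw-free-decomp-< b (U - x)
        (≤-trans (size-< x (λ y y∈ → proj₁ (∈-delete⁻ U y∈)) x∈U (∉-delete U x)) size≤b)
        (λ c∈ a∈ b∈ p∈ → paw-free (↑ c∈) (↑ a∈) (↑ b∈) (↑ p∈))
        where
        ↑ : ∀ {y} → y ∈ U - x → y ∈ U
        ↑ y∈ = proj₁ (∈-delete⁻ U y∈)
      isolated : (∀ {w} → w ∈ U → w ≁ v) → Decomp (Uniform U) U
      isolated v≁ = node (U - v) (λ y → eq? y v) split (λ y y∈ → eq?-≢ (proj₂ (∈-delete⁻ U y∈))) (uniform-full U)
        (decomp-map (λ S⊆ → weaken S⊆) (λ _ y∈ → y∈) (smaller v v∈U)) (leaf v (eq?-refl v) λ y → eq?⁻)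
        where
        split : ∀ y → U y ≡ (U - v) y ∨ eq? y v
        split y with y ≟ᶠ v
        ... | yes refl = trans v∈U (sym (∨-trueʳ (U y ∧ _) refl))
        ... | no _ = sym (trans (∨-identityʳ _) (∧-identityʳ _))
        weaken : ∀ {S} → S ⊑ (U - v) → Uniform (U - v) S → Uniform U S
        weaken {S} S⊆ (active , inert , alike) = active
          , (λ {u} {w} u∈S a w∈U w∉S → inert′ u∈S a w∈U w∉S (w ≟ᶠ v))
          , (λ {u} {u′} {w} u∈S u′∈S a a′ w∈U w∉S → alike′ u∈S u′∈S a a′ w∈U w∉S (w ≟ᶠ v))
          where
          off : ∀ {u} → u ∈ S → u ≁ v
          off u∈S = v≁ (proj₁ (∈-delete⁻ U (S⊆ _ u∈S)))
          inert′ : ∀ {u w} → u ∈ S → u ∉ active → w ∈ U → w ∉ S → Dec (w ≡ v) → u ≁ w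
          inert′ u∈S a w∈U w∉S (yes refl) = off u∈S
          inert′ u∈S a w∈U w∉S (no w≢v) = inert u∈S a (∈-delete⁺ U w∈U w≢v) w∉S
          alike′ : ∀ {u u′ w} → u ∈ S → u′ ∈ S → u ∈ active → u′ ∈ active → w ∈ U → w ∉ S → Dec (w ≡ v) →
                   adj G u w ≡ adj G u′ w
          alike′ u∈S u′∈S a a′ w∈U w∉S (yes refl) = trans (off u∈S) (sym (off u′∈S))
          alike′ u∈S u′∈S a a′ w∈U w∉S (no w≢v) = alike u∈S u′∈S a a′ (∈-delete⁺ U w∈U w≢v) w∉S
      -- A neighbour w of v sees both p and q because v is simplicial. If w misses v but sees one of
      -- them, that one is the centre of the triangle with v and the other, and paw-freeness makes w
      -- see the other.
      twins : ∀ {p q} → p ∈ U → q ∈ U → v ~ p → v ~ q → p ≢ q → ∀ {w} → w ∈ U - q → w ≢ p → adj G w q ≡ adj G w p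
      twins {p} {q} p∈U q∈U v~p v~q p≢q {w} w∈ w≢p with ∈-delete⁻ U w∈ | v ≟ᶠ w
      ... | w∈U , w≢q | yes refl = trans v~q (sym v~p)
      ... | w∈U , w≢q | no v≢w with ~? v w
      ...   | inj₁ v~w = trans (simp w∈U q∈U v~w v~q w≢q) (sym (simp w∈U p∈U v~w v~p w≢p))
      ...   | inj₂ v≁w = ≡-from-⇔ (along q∈U p∈U v~q v~p (λ e → p≢q (sym e))) (along p∈U q∈U v~p v~q p≢q)
        where
        along : ∀ {a b} → a ∈ U → b ∈ U → v ~ a → v ~ b → a ≢ b → w ~ a → w ~ b
        along a∈U b∈U v~a v~b a≢b w~a with
          paw-free a∈U b∈U v∈U w∈U (simp a∈U b∈U v~a v~b a≢b) (~-sym v~a) (~-sym v~b) (~-sym w~a)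
        ... | inj₁ w~b = w~b
        ... | inj₂ w~v = ⊥-elim (clash (~-sym w~v) v≁w)
      branch : Decomp (Uniform U) U
      branch with any? (λ p → (U p ≟ true) ×-dec (adj G v p ≟ true))
      ... | no none = isolated λ {w} w∈U → ≢true⇒≡false λ w~v → none (w , w∈U , ~-sym w~v)
      ... | yes (p , p∈U , v~p) with any? (λ q → (U q ≟ true) ×-dec (adj G v q ≟ true) ×-dec ¬? (p ≟ᶠ q))
      ...   | no one = extend v∈U (beside-pendant pendant) (smaller v v∈U)
        where
        open Insertion U v p p∈U (λ e → ~⇒≢ v~p (sym e))
        pendant : ∀ {w} → w ∈ U - v → w ≢ p → w ≁ v
        pendant {w} w∈ w≢p = ≢true⇒≡false λ w~v →
          one (w , proj₁ (∈-delete⁻ U w∈) , ~-sym w~v , λ e → w≢p (sym e))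
      ...   | yes (q , q∈U , v~q , p≢q) =
              extend q∈U (beside-twin (twins p∈U q∈U v~p v~q p≢q)) (smaller q q∈U)
        where open Insertion U q p p∈U p≢q

    paw-free-decomp : ∀ U → PawFree U → Decomp (Uniform U) U
    paw-free-decomp U = paw-free-decomp-< _ U ≤-refl

    -- Excluding P1 + paw: the laminar family of missed sets

    module Pawless (free : Free P1+paw G) where

      no-P1+paw : ∀ {z c a b p} → c ~ a → c ~ b → a ~ b → c ~ p → p ≁ a → p ≁ b →
                  z ≁ c → z ≁ a → z ≁ b → z ≁ p → ⊥
      no-P1+paw {z} {c} {a} {b} {p} ca cb ab cp pa pb zc za zb zp = free (f , inj _ _ , hom)
        where
        f : Fin 5 → V
        f 0F = z
        f 1F = c
        f 2F = a
        -- Complementing turns the single vertex of `P 1` into the centre and the middle of `P 3`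
        -- into the pendant vertex, which therefore sits between `a` and `b`.
        f 3F = p
        f 4F = b
        z≢ : ∀ {y} w → y ~ w → z ≁ w → z ≢ y
        z≢ w y~w z≁w refl = clash y~w z≁w
        inj : ∀ i j → f i ≡ f j → i ≡ j
        inj 0F 0F _ = refl
        inj 0F 1F e = ⊥-elim (z≢ a ca za e)
        inj 0F 2F e = ⊥-elim (z≢ c (~-sym ca) zc e)
        inj 0F 3F e = ⊥-elim (z≢ c (~-sym cp) zc e)
        inj 0F 4F e = ⊥-elim (z≢ c (~-sym cb) zc e)
        inj 1F 0F e = ⊥-elim (z≢ a ca za (sym e))
        inj 1F 1F _ = refl
        inj 1F 2F e = ⊥-elim (~⇒≢ ca e)
        inj 1F 3F e = ⊥-elim (~⇒≢ cp e)
        inj 1F 4F e = ⊥-elim (~⇒≢ cb e)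
        inj 2F 0F e = ⊥-elim (z≢ c (~-sym ca) zc (sym e))
        inj 2F 1F e = ⊥-elim (~⇒≢ ca (sym e))
        inj 2F 2F _ = refl
        inj 2F 3F e = ⊥-elim (separates ab pb e)
        inj 2F 4F e = ⊥-elim (~⇒≢ ab e)
        inj 3F 0F e = ⊥-elim (z≢ c (~-sym cp) zc (sym e))
        inj 3F 1F e = ⊥-elim (~⇒≢ cp (sym e))
        inj 3F 2F e = ⊥-elim (separates ab pb (sym e))
        inj 3F 3F _ = refl
        inj 3F 4F e = ⊥-elim (separates (~-sym ab) pa (sym e))
        inj 4F 0F e = ⊥-elim (z≢ c (~-sym cb) zc (sym e))
        inj 4F 1F e = ⊥-elim (~⇒≢ cb (sym e))
        inj 4F 2F e = ⊥-elim (~⇒≢ ab (sym e))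
        inj 4F 3F e = ⊥-elim (separates (~-sym ab) pa e)
        inj 4F 4F _ = refl
        hom : ∀ i j → adj P1+paw i j ≡ adj G (f i) (f j)
        hom 0F 0F = sym (proj₂ simple z)
        hom 0F 1F = sym zc
        hom 0F 2F = sym za
        hom 0F 3F = sym zp
        hom 0F 4F = sym zb
        hom 1F 0F = sym (≁-sym zc)
        hom 1F 1F = sym (proj₂ simple c)
        hom 1F 2F = sym ca
        hom 1F 3F = sym cp
        hom 1F 4F = sym cb
        hom 2F 0F = sym (≁-sym za)
        hom 2F 1F = sym (~-sym ca)
        hom 2F 2F = sym (proj₂ simple a)
        hom 2F 3F = sym (≁-sym pa)
        hom 2F 4F = sym ab
        hom 3F 0F = sym (≁-sym zp)
        hom 3F 1F = sym (~-sym cp)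
        hom 3F 2F = sym pa
        hom 3F 3F = sym (proj₂ simple p)
        hom 3F 4F = sym pb
        hom 4F 0F = sym (≁-sym zb)
        hom 4F 1F = sym (~-sym cb)
        hom 4F 2F = sym (~-sym ab)
        hom 4F 3F = sym (≁-sym pb)
        hom 4F 4F = sym (proj₂ simple b)

      module Around (v : V) (v-simp : ∀ {x y} → v ~ x → v ~ y → x ≢ y → x ~ y) where

        Far : V → Set
        Far d = d ≢ v × v ≁ d

        -- Vertices of N(v) missed by a far vertex d; these sets form a laminar family.
        Misses : V → V → Set
        Misses d k = v ~ k × d ≁ k

        X F : V → Set
        X d = Far d × ∃ (Misses d)
        F d = Far d × (∀ k → v ~ k → d ~ k)

        infix 4 _⊴_ _◁_
        -- Inclusion and strict inclusion of missed sets. On vertices this is only a preorder, since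
        -- different far vertices may miss the same set.
        _⊴_ _◁_ : V → V → Set
        d ⊴ d′ = ∀ k → v ~ k → d ≁ k → d′ ≁ k
        d ◁ d′ = d ⊴ d′ × ∃ λ k → Misses d′ k × d ~ k

        far? : Decidable Far
        far? d = ¬? (d ≟ᶠ v) ×-dec (adj G v d ≟ false)

        misses? : ∀ d → Decidable (Misses d)
        misses? d k = (adj G v k ≟ true) ×-dec (adj G d k ≟ false)

        x? : Decidable X
        x? d = far? d ×-dec any? (misses? d)

        f? : Decidable F
        f? d = far? d ×-dec all? λ k → (adj G v k ≟ true) →-dec (adj G d k ≟ true)

        ⊴? : ∀ d d′ → d ⊴ d′ ⊎ ∃ λ k → Misses d k × d′ ~ k
        ⊴? d d′ with any? (λ k → misses? d k ×-dec (adj G d′ k ≟ true))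
        ... | yes found = inj₂ found
        ... | no none   = inj₁ λ k v~k d≁k → ≢true⇒≡false λ d′~k → none (k , (v~k , d≁k) , d′~k)

        ⊴-trans : ∀ {a b c} → a ⊴ b → b ⊴ c → a ⊴ c
        ⊴-trans p q k v~k a≁k = q k v~k (p k v~k a≁k)

        ⊴-adj : ∀ {a b k} → a ⊴ b → b ⊴ a → v ~ k → adj G a k ≡ adj G b k
        ⊴-adj {a} {b} {k} p q v~k = ≡-from-⇔ (keep q) (keep p)
          where
          keep : ∀ {a b} → b ⊴ a → a ~ k → b ~ k
          keep {a} {b} q a~k with ~? b k
          ... | inj₁ b~k = b~k
          ... | inj₂ b≁k = ⊥-elim (clash a~k (q k v~k b≁k))

        ◁⇒⋬ : ∀ {d d′} → d ◁ d′ → ¬ d′ ⊴ d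
        ◁⇒⋬ (_ , k , (v~k , d′≁k) , d~k) d′⊴d = clash d~k (d′⊴d k v~k d′≁k)

        X⊎F : ∀ {d} → Far d → X d ⊎ F d
        X⊎F {d} far with any? (misses? d)
        ... | yes m = inj₁ (far , m)
        ... | no ¬m = inj₂ (far , λ k v~k → case ~? d k of λ
                { (inj₁ h) → h ; (inj₂ h) → ⊥-elim (¬m (k , v~k , h)) })

        ¬X-F : ∀ {d} → X d → F d → ⊥
        ¬X-F (_ , k , v~k , d≁k) (_ , full) = clash (full k v~k) d≁k

        -- If k is missed by d alone and k′ by d′ alone, then d, d′, k, k′ is an induced C4, the
        -- edge k k′ coming from the clique N(v).
        adjacent⇒comparable : ∀ {d d′} → v ≁ d → v ≁ d′ → d ~ d′ → d ⊴ d′ ⊎ d′ ⊴ d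
        adjacent⇒comparable {d} {d′} v≁d v≁d′ d~d′ with ⊴? d d′ | ⊴? d′ d
        ... | inj₁ p | _ = inj₁ p
        ... | _ | inj₁ q = inj₂ q
        ... | inj₂ (k , (v~k , d≁k) , d′~k) | inj₂ (k′ , (v~k′ , d′≁k′) , d~k′) =
          ⊥-elim (no-C4 d~d′ d′~k (v-simp v~k v~k′ λ { refl → clash d′~k d′≁k′ }) (~-sym d~k′) d≁k d′≁k′
            (λ { refl → clash v~k v≁d }) (λ { refl → clash v~k′ v≁d′ }))

        -- A vertex k₁ missed by d but seen by d′ forms a triangle with k and v. With d′ pendant at
        -- k₁ this is a paw, and d misses all of it.
        shared⇒⊴ : ∀ {d d′ k} → v ≁ d → v ≁ d′ → d ≁ d′ → Misses d k → Misses d′ k → d ⊴ d′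
        shared⇒⊴ {d} {d′} {k} v≁d v≁d′ d≁d′ (v~k , d≁k) (_ , d′≁k) k₁ v~k₁ d≁k₁ = ≢true⇒≡false λ d′~k₁ →
          no-P1+paw (v-simp v~k₁ v~k (separates (~-sym d′~k₁) (≁-sym d′≁k))) (~-sym v~k₁) (~-sym v~k) (~-sym d′~k₁)
            d′≁k (≁-sym v≁d′) d≁k₁ d≁k (≁-sym v≁d) d≁d′

        -- The smaller missed set is nonempty, hence shared; nonadjacency would then give the
        -- reverse inclusion by `shared⇒⊴`.
        ◁⇒adjacent : ∀ {d d′} → X d → Far d′ → d ◁ d′ → d ~ d′
        ◁⇒adjacent {d} {d′} ((_ , v≁d) , k , v~k , d≁k) (_ , v≁d′) d◁d′@(d⊴d′ , _) with ~? d d′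
        ... | inj₁ h = h
        ... | inj₂ h = ⊥-elim (◁⇒⋬ d◁d′ (shared⇒⊴ v≁d′ v≁d (≁-sym h) (v~k , d⊴d′ k v~k d≁k) (v~k , d≁k)))

        Disjoint : V → V → Set
        Disjoint d d′ = ∀ k → v ~ k → d ≁ k → d′ ~ k

        disjoint⇒nonadjacent : ∀ {d d′} → X d → X d′ → Disjoint d d′ → d ≁ d′
        disjoint⇒nonadjacent {d} {d′} ((_ , v≁d) , k , v~k , d≁k) ((_ , v≁d′) , k′ , v~k′ , d′≁k′) disj =
          ≢true⇒≡false λ d~d′ → case adjacent⇒comparable v≁d v≁d′ d~d′ of λ
            { (inj₁ p) → clash (disj k v~k d≁k) (p k v~k d≁k)
            ; (inj₂ q) → clash (disj k′ v~k′ (q k′ v~k′ d′≁k′)) d′≁k′ }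

        -- When the missed sets meet, nonadjacent vertices are handled by the paw argument and
        -- adjacent ones by the C4 argument.
        laminar : ∀ {d d′} → X d → X d′ → d ⊴ d′ ⊎ d′ ⊴ d ⊎ Disjoint d d′
        laminar {d} {d′} ((_ , v≁d) , _) ((_ , v≁d′) , _) with any? (λ k → misses? d k ×-dec (adj G d′ k ≟ false))
        ... | no none = inj₂ (inj₂ λ k v~k d≁k → case ~? d′ k of λ
                { (inj₁ h) → h ; (inj₂ h) → ⊥-elim (none (k , (v~k , d≁k) , h)) })
        ... | yes (k , (v~k , d≁k) , d′≁k) with ~? d d′
        ...   | inj₂ d≁d′ = inj₁ (shared⇒⊴ v≁d v≁d′ d≁d′ (v~k , d≁k) (v~k , d′≁k))
        ...   | inj₁ d~d′ with adjacent⇒comparable v≁d v≁d′ d~d′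
        ...     | inj₁ p = inj₁ p
        ...     | inj₂ q = inj₂ (inj₁ q)

        -- Otherwise k, a, b is a triangle with v pendant at k, and d is isolated from this paw.
        edge-dominates : ∀ {a b k d} → v ≁ a → v ≁ b → v ≁ d → a ~ b → v ~ k → a ~ k → b ~ k → d ≁ k → d ~ a ⊎ d ~ b
        edge-dominates {a} {b} {k} {d} v≁a v≁b v≁d a~b v~k a~k b~k d≁k with ~? d a | ~? d b
        ... | inj₁ h | _ = inj₁ h
        ... | _ | inj₁ h = inj₂ h
        ... | inj₂ d≁a | inj₂ d≁b = ⊥-elim (no-P1+paw (~-sym a~k) (~-sym b~k) a~b (~-sym v~k) v≁a v≁b
                d≁k d≁a d≁b (≁-sym v≁d))

        -- Take k seen by d and missed by d′. If f missed d, then f, d′, d, k would be an induced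
        -- C4, because f sees all of N(v).
        ◁⇒fewer-F : ∀ {f d d′} → F f → X d → X d′ → d ◁ d′ → f ~ d′ → f ~ d
        ◁⇒fewer-F {f} {d} {d′} Ff@(_ , full) Xd Xd′ d◁d′@(_ , k , (v~k , d′≁k) , d~k) f~d′ with ~? f d
        ... | inj₁ h = h
        ... | inj₂ f≁d = ⊥-elim (no-C4 f~d′ (~-sym (◁⇒adjacent Xd (proj₁ Xd′) d◁d′)) d~k (~-sym (full k v~k)) f≁d d′≁k
                (λ { refl → ¬X-F Xd Ff }) (λ { refl → clash v~k (proj₂ (proj₁ Xd′)) }))

        -- If d sees some k that d′ misses, the edge f d lies in the neighbourhood of k and must be
        -- dominated by d′. As d′ misses f, it sees d, and adjacent far vertices are comparable.
        F-differ⇒comparable : ∀ {f d d′} → F f → X d → X d′ → f ~ d → f ≁ d′ → d ⊴ d′ ⊎ d′ ⊴ d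
        F-differ⇒comparable {f} {d} {d′} ((_ , v≁f) , full) ((_ , v≁d) , _) ((_ , v≁d′) , _) f~d f≁d′ with ⊴? d′ d
        ... | inj₁ p = inj₂ p
        ... | inj₂ (k , (v~k , d′≁k) , d~k) with edge-dominates v≁f v≁d v≁d′ f~d v~k (full k v~k) d~k d′≁k
        ...   | inj₁ d′~f = ⊥-elim (clash (~-sym d′~f) f≁d′)
        ...   | inj₂ d′~d = adjacent⇒comparable v≁d v≁d′ (~-sym d′~d)

        -- Here `v` is the isolated vertex. `PawFree` allows p to be a or b, where the edge between
        -- a and b gives the conclusion.
        far-paw-free : ∀ {U} → (∀ {x} → x ∈ U → Far x) → PawFree U
        far-paw-free far {c} {a} {b} {p} c∈ a∈ b∈ p∈ c~a c~b a~b c~p with ~? p a | ~? p b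
        ... | inj₁ h | _ = inj₁ h
        ... | _ | inj₁ h = inj₂ h
        ... | inj₂ p≁a | inj₂ p≁b = ⊥-elim (no-P1+paw c~a c~b a~b c~p p≁a p≁b
                (proj₂ (far c∈)) (proj₂ (far a∈)) (proj₂ (far b∈)) (proj₂ (far p∈)))

        -- Splitting the graph along the laminar family

        Label : Set
        Label = Bool × Bool × Bool

        -- K ∪ Y is split along the laminar family, and the remaining far vertices R as a paw-free graph;
        -- sideR and sideK bound the number of neighbourhood types across the cuts.
        record Layout : Set where
          field
            Y       : VSet (n G)
            Y⊆X     : ∀ {d} → d ∈ Y → X d
            sideR   : V → Bool × Bool
            sideK   : V → Bool × Bool
          R : VSet (n G)
          R d = does (far? d) ∧ not (Y d)
          field
            R-alike : ∀ {r r′ w} → r ∈ R → r′ ∈ R → sideR r ≡ sideR r′ → w ∉ R → adj G r w ≡ adj G r′ w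
            K-alike : ∀ {k k′ r} → v ~ k → v ~ k′ → sideK k ≡ sideK k′ → r ∈ R → adj G k r ≡ adj G k′ r
            Y-alike : ∀ {y y′ r} → y ∈ Y → y′ ∈ Y → r ∈ R → adj G y r ≡ adj G y′ r

        module Build (layout : Layout) where
          open Layout layout

          K : VSet (n G)
          K = adj G v

          Y-far : ∀ {d} → d ∈ Y → Far d
          Y-far d∈Y = proj₁ (Y⊆X d∈Y)

          Y∩K=∅ : ∀ {d} → d ∈ Y → d ∉ K
          Y∩K=∅ d∈Y = proj₂ (Y-far d∈Y)

          v∉Y : v ∉ Y
          v∉Y = ≢true⇒≡false λ v∈Y → proj₁ (Y-far v∈Y) refl

          R⁻ : ∀ {d} → d ∈ R → Far d × d ∉ Y
          R⁻ {d} h = let a , b = ∧-true⁻ h in does⁻ (far? d) a , not-injective b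

          data Kind (w : V) : Set where
            is-v : w ≡ v → Kind w
            in-K : w ∈ K → Kind w
            in-Y : w ∈ Y → Kind w
            in-R : w ∈ R → Kind w

          kind : ∀ w → Kind w
          kind w with w ≟ᶠ v | bool-cases (K w) | bool-cases (Y w)
          ... | yes e | _ | _ = is-v e
          ... | no _ | inj₁ h | _ = in-K h
          ... | no _ | inj₂ _ | inj₁ h = in-Y h
          ... | no w≢v | inj₂ w∉K | inj₂ w∉Y =
                in-R (cong₂ (λ a b → a ∧ not b) (dec-true (far? w) (w≢v , w∉K)) w∉Y)

          decomp-R : Decomp (Types G Label) R
          decomp-R = decomp-map types (λ _ x∈ → x∈) (paw-free-decomp R (far-paw-free (λ x∈ → proj₁ (R⁻ x∈))))
            where
            types : ∀ {S} → S ⊑ R → Uniform R S → Types G Label S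
            -- Within `R` the single bit of the paw-free decomposition suffices; the two bits of
            -- `sideR` take care of everything outside `R`.
            types {S} S⊆R (active , inert , alike) = (λ u → active u , sideR u) , sep
              where
              sep : Separated G S (λ u → active u , sideR u)
              sep {u} {u′} {w} u∈ u′∈ e w∉ with bool-cases (R w)
              ... | inj₂ w∉R = R-alike (S⊆R u u∈) (S⊆R u′ u′∈) (cong proj₂ e) w∉R
              ... | inj₁ w∈R with bool-cases (active u)
              ...   | inj₁ a = alike u∈ u′∈ a (trans (sym (cong proj₁ e)) a) w∈R w∉
              ...   | inj₂ a = trans (inert u∈ a w∈R w∉) (sym (inert u′∈ (trans (sym (cong proj₁ e)) a) w∈R w∉))

          KY : V → Set
          KY w = w ∈ K ⊎ w ∈ Y

          -- This reduces a cut to its part inside K ∪ `Y`: `v` is complete to K and misses `Y`, and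
          -- the layout controls the adjacency to `R`.
          KY-types : ∀ {S} → (∀ {x} → x ∈ S → KY x) → (active : VSet (n G)) →
            (∀ {k k′ w} → k ∈ S → k′ ∈ S → k ∈ K → k′ ∈ K → KY w → w ∉ S → adj G k w ≡ adj G k′ w) →
            (∀ {y y′ w} → y ∈ S → y′ ∈ S → y ∈ Y → y′ ∈ Y → active y ≡ active y′ → KY w → w ∉ S → adj G y w ≡ adj G y′ w) →
            Types G Label S
          KY-types {S} S⊆ active K-hom Y-hom = class , sep
            where
            -- The first bit tells K from `Y`, so the other two can carry `sideK` on K and the
            -- activity bit on `Y`.
            class : V → Label
            class u = K u , (if K u then sideK u else (active u , false))
            sameK : ∀ {u u′} → u ∈ K → u′ ∈ K → class u ≡ class u′ → sideK u ≡ sideK u′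
            sameK u∈K u′∈K e = trans (sym (cong (if_then _ else _) u∈K)) (trans (cong proj₂ e) (cong (if_then _ else _) u′∈K))
            sameY : ∀ {u u′} → u ∉ K → u′ ∉ K → class u ≡ class u′ → active u ≡ active u′
            sameY u∉K u′∉K e = cong proj₁ (trans (sym (cong (if_then _ else _) u∉K)) (trans (cong proj₂ e) (cong (if_then _ else _) u′∉K)))
            sep : Separated G S class
            sep {u} {u′} {w} u∈ u′∈ e w∉ with S⊆ u∈ | S⊆ u′∈ | kind w
            ... | inj₁ u∈K | inj₂ u′∈Y | _ = ⊥-elim (clash (trans (sym (cong proj₁ e)) u∈K) (Y∩K=∅ u′∈Y))
            ... | inj₂ u∈Y | inj₁ u′∈K | _ = ⊥-elim (clash (trans (cong proj₁ e) u′∈K) (Y∩K=∅ u∈Y))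
            ... | inj₁ u∈K | inj₁ u′∈K | is-v refl = trans (~-sym u∈K) (sym (~-sym u′∈K))
            ... | inj₁ u∈K | inj₁ u′∈K | in-K h = K-hom u∈ u′∈ u∈K u′∈K (inj₁ h) w∉
            ... | inj₁ u∈K | inj₁ u′∈K | in-Y h = K-hom u∈ u′∈ u∈K u′∈K (inj₂ h) w∉
            ... | inj₁ u∈K | inj₁ u′∈K | in-R h = K-alike u∈K u′∈K (sameK u∈K u′∈K e) h
            ... | inj₂ u∈Y | inj₂ u′∈Y | is-v refl = trans (≁-sym (Y∩K=∅ u∈Y)) (sym (≁-sym (Y∩K=∅ u′∈Y)))
            ... | inj₂ u∈Y | inj₂ u′∈Y | in-K h = Y-hom u∈ u′∈ u∈Y u′∈Y (sameY (Y∩K=∅ u∈Y) (Y∩K=∅ u′∈Y) e) (inj₁ h) w∉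
            ... | inj₂ u∈Y | inj₂ u′∈Y | in-Y h = Y-hom u∈ u′∈ u∈Y u′∈Y (sameY (Y∩K=∅ u∈Y) (Y∩K=∅ u′∈Y) e) (inj₂ h) w∉
            ... | inj₂ u∈Y | inj₂ u′∈Y | in-R h = Y-alike u∈Y u′∈Y h

          Within Full Apart : VSet (n G) → V → Set
          Within T d = ∀ k → v ~ k → d ≁ k → k ∈ T
          Full   T d = ∀ k → k ∈ T → d ≁ k
          Apart  T d = ∀ k → k ∈ T → d ~ k

          -- No missed set of a vertex of `Y` crosses `T`: it lies inside `T`, contains `T`, or
          -- avoids it. For `T` inside K this says that `T` could be added to the laminar family.
          Closed : VSet (n G) → Set
          Closed T = ∀ {d} → d ∈ Y → Within T d ⊎ Full T d ⊎ Apart T d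

          within? : ∀ T → Decidable (Within T)
          within? T d = all? λ k → (adj G v k ≟ true) →-dec (adj G d k ≟ false) →-dec (T k ≟ true)

          full? : ∀ T → Decidable (Full T)
          full? T d = all? λ k → (T k ≟ true) →-dec (adj G d k ≟ false)

          -- For `T` inside K, these are M(d) strictly inside `T` and M(d) = `T`. The former are
          -- passed on when `T` is split further; the latter look the same from K and form a
          -- paw-free part of their own.
          Core Top : VSet (n G) → V → Set
          Core T d = d ∈ Y × Within T d × ¬ Full T d
          Top  T d = d ∈ Y × Within T d × Full T d

          core? : ∀ T → Decidable (Core T)
          core? T d = (Y d ≟ true) ×-dec within? T d ×-dec ¬? (full? T d)

          top? : ∀ T → Decidable (Top T)
          top? T d = (Y d ≟ true) ×-dec within? T d ×-dec full? T d

          core top block : VSet (n G) → VSet (n G)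
          core  T x = T x ∨ does (core? T x)
          top   T x = does (top? T x)
          block T x = core T x ∨ top T x

          core⁻ : ∀ T {x} → x ∈ core T → x ∈ T ⊎ Core T x
          core⁻ T {x} h with ∨-true⁻ {T x} h
          ... | inj₁ p = inj₁ p
          ... | inj₂ p = inj₂ (does⁻ (core? T x) p)

          top⁻ : ∀ T {x} → x ∈ top T → Top T x
          top⁻ T {x} = does⁻ (top? T x)

          core-K⁺ : ∀ T {x} → x ∈ T → x ∈ core T
          core-K⁺ T = ∨-trueˡ _

          core-Y⁺ : ∀ T {x} → Core T x → x ∈ core T
          core-Y⁺ T {x} c = ∨-trueʳ (T x) (dec-true (core? T x) c)

          block-Y⁺ : ∀ T {x} → x ∈ Y → Within T x → x ∈ block T
          block-Y⁺ T {x} x∈Y w with full? T x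
          ... | no ¬f = ∨-trueˡ _ (core-Y⁺ T (x∈Y , w , ¬f))
          ... | yes f = ∨-trueʳ (core T x) (dec-true (top? T x) (x∈Y , w , f))

          block⁻ : ∀ T {x} → x ∈ block T → x ∈ T ⊎ (x ∈ Y × Within T x)
          block⁻ T {x} h with ∨-true⁻ {core T x} h
          ... | inj₂ p = let y , w , _ = top⁻ T p in inj₂ (y , w)
          ... | inj₁ p with core⁻ T p
          ...   | inj₁ q = inj₁ q
          ...   | inj₂ (y , w , _) = inj₂ (y , w)

          missed : ∀ {d} → d ∈ Y → ∃ (Misses d)
          missed d∈Y = proj₂ (Y⊆X d∈Y)

          -- In the first alternative inclusion of missed sets follows from passing through `T`; the
          -- second component adds the strictness that `◁⇒adjacent` requires.
          Outside : VSet (n G) → VSet (n G) → V → Set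
          Outside T S w = (Full T w × (∀ y → y ∈ S → y ∈ Y → ∃ λ k → Misses w k × y ~ k)) ⊎ Apart T w

          -- A vertex of Y outside S sees all or none of S ∩ K, and correspondingly none or all of S ∩ Y.
          module _ {T S : VSet (n G)} (T⊆K : T ⊑ K)
                   (S⁻ : ∀ {x} → x ∈ S → x ∈ T ⊎ (x ∈ Y × Within T x)) (T⊆S : T ⊑ S)
                   (outside : ∀ {w} → w ∈ Y → w ∉ S → Outside T S w) where

            nested-types : Types G Label S
            nested-types = KY-types (λ x∈ → case S⁻ x∈ of λ { (inj₁ p) → inj₁ (T⊆K _ p) ; (inj₂ (p , _)) → inj₂ p })
              (λ _ → false) K-hom Y-hom
              where
              S∩K : ∀ {k} → k ∈ S → k ∈ K → k ∈ T
              S∩K k∈S k∈K with S⁻ k∈S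
              ... | inj₁ p = p
              ... | inj₂ (p , _) = ⊥-elim (clash k∈K (Y∩K=∅ p))
              S∩Y : ∀ {y} → y ∈ S → y ∈ Y → Within T y
              S∩Y y∈S y∈Y with S⁻ y∈S
              ... | inj₁ p = ⊥-elim (clash (T⊆K _ p) (Y∩K=∅ y∈Y))
              ... | inj₂ (_ , p) = p
              ∉T : ∀ {w} → w ∉ S → w ∉ T
              ∉T w∉S = ≢true⇒≡false λ w∈T → clash (T⊆S _ w∈T) w∉S
              K-hom : ∀ {k k′ w} → k ∈ S → k′ ∈ S → k ∈ K → k′ ∈ K → KY w → w ∉ S → adj G k w ≡ adj G k′ w
              K-hom k∈ k′∈ k∈K k′∈K (inj₁ w∈K) w∉ =
                trans (v-simp k∈K w∈K (λ { refl → clash k∈ w∉ })) (sym (v-simp k′∈K w∈K (λ { refl → clash k′∈ w∉ })))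
              K-hom k∈ k′∈ k∈K k′∈K (inj₂ w∈Y) w∉ with outside w∈Y w∉
              ... | inj₁ (f , _) = trans (≁-sym (f _ (S∩K k∈ k∈K))) (sym (≁-sym (f _ (S∩K k′∈ k′∈K))))
              ... | inj₂ a = trans (~-sym (a _ (S∩K k∈ k∈K))) (sym (~-sym (a _ (S∩K k′∈ k′∈K))))
              Y-hom : ∀ {y y′ w} → y ∈ S → y′ ∈ S → y ∈ Y → y′ ∈ Y → false ≡ false → KY w → w ∉ S → adj G y w ≡ adj G y′ w
              Y-hom y∈ y′∈ y∈Y y′∈Y _ (inj₁ w∈K) w∉ = trans (sees y∈ y∈Y) (sym (sees y′∈ y′∈Y))
                where
                sees : ∀ {y} → y ∈ S → y ∈ Y → y ~ _
                sees {y} y∈ y∈Y with ~? y _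
                ... | inj₁ h = h
                ... | inj₂ h = ⊥-elim (clash (S∩Y y∈ y∈Y _ w∈K h) (∉T w∉))
              Y-hom y∈ y′∈ y∈Y y′∈Y _ (inj₂ w∈Y) w∉ with outside w∈Y w∉
              ... | inj₁ (f , strict) = trans (sees y∈ y∈Y) (sym (sees y′∈ y′∈Y))
                where
                sees : ∀ {y} → y ∈ S → y ∈ Y → y ~ _
                sees {y} y∈ y∈Y = ◁⇒adjacent (Y⊆X y∈Y) (Y-far w∈Y)
                  ((λ k v~k y≁k → f k (S∩Y y∈ y∈Y k v~k y≁k)) , strict y y∈ y∈Y)
              ... | inj₂ a = trans (avoids y∈ y∈Y) (sym (avoids y′∈ y′∈Y))
                where
                avoids : ∀ {y} → y ∈ S → y ∈ Y → y ≁ _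
                avoids {y} y∈ y∈Y = disjoint⇒nonadjacent (Y⊆X y∈Y) (Y⊆X w∈Y)
                  (λ k v~k y≁k → a k (S∩Y y∈ y∈Y k v~k y≁k))

          ¬Within⇒ : ∀ {T d} → ¬ Within T d → ∃ λ k → Misses d k × k ∉ T
          ¬Within⇒ {T} {d} ¬w with any? (λ k → misses? d k ×-dec (T k ≟ false))
          ... | yes found = found
          ... | no none = ⊥-elim (¬w λ k v~k d≁k → case bool-cases (T k) of λ
                  { (inj₁ h) → h ; (inj₂ h) → ⊥-elim (none (k , (v~k , d≁k) , h)) })

          ¬Full⇒ : ∀ {T d} → ¬ Full T d → ∃ λ k → k ∈ T × d ~ k
          ¬Full⇒ {T} {d} ¬f with any? (λ k → (T k ≟ true) ×-dec (adj G d k ≟ true))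
          ... | yes found = found
          ... | no none = ⊥-elim (¬f λ k k∈T → ≢true⇒≡false λ h → none (k , k∈T , h))

          module Split {T : VSet (n G)} (T⊆K : T ⊑ K) (closed : Closed T) where

            beyond : ∀ {w y} → ¬ Within T w → Within T y → ∃ λ k → Misses w k × y ~ k
            beyond {w} {y} ¬w wy = let k , (v~k , w≁k) , k∉T = ¬Within⇒ ¬w in k , (v~k , w≁k) ,
              (case ~? y k of λ { (inj₁ h) → h ; (inj₂ h) → ⊥-elim (clash (wy k v~k h) k∉T) })

            block-types : Types G Label (block T)
            block-types = nested-types T⊆K (block⁻ T) (λ x x∈T → ∨-trueˡ _ (core-K⁺ T x∈T)) outside
              where
              outside : ∀ {w} → w ∈ Y → w ∉ block T → Outside T (block T) w
              outside {w} w∈Y w∉ with closed w∈Y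
              ... | inj₁ p = ⊥-elim (clash (block-Y⁺ T w∈Y p) w∉)
              ... | inj₂ (inj₂ a) = inj₂ a
              ... | inj₂ (inj₁ f) = inj₁ (f , λ y y∈ y∈Y → case block⁻ T y∈ of λ
                      { (inj₁ y∈T) → ⊥-elim (clash (T⊆K _ y∈T) (Y∩K=∅ y∈Y))
                      ; (inj₂ (_ , wy)) → beyond (λ p → clash (block-Y⁺ T w∈Y p) w∉) wy })

            -- Unlike for `block T`, a vertex missing exactly `T` may now lie outside. Strictness
            -- then comes from the core vertices, which do not miss all of `T`.
            core-types : Types G Label (core T)
            core-types = nested-types T⊆K (λ x∈ → block⁻ T (∨-trueˡ _ x∈)) (λ x → core-K⁺ T) outside
              where
              full : ∀ {w} → Full T w → Outside T (core T) w
              full {w} f = inj₁ (f , strict)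
                where
                strict : ∀ y → y ∈ core T → y ∈ Y → ∃ λ k → Misses w k × y ~ k
                strict y y∈ y∈Y with core⁻ T y∈
                ... | inj₁ y∈T = ⊥-elim (clash (T⊆K _ y∈T) (Y∩K=∅ y∈Y))
                ... | inj₂ (_ , _ , ¬f) = let k , k∈T , y~k = ¬Full⇒ ¬f in k , (T⊆K k k∈T , f k k∈T) , y~k
              outside : ∀ {w} → w ∈ Y → w ∉ core T → Outside T (core T) w
              outside {w} w∈Y w∉ with closed w∈Y
              ... | inj₂ (inj₂ a) = inj₂ a
              ... | inj₂ (inj₁ f) = full f
              ... | inj₁ p with full? T w
              ...   | no ¬f = ⊥-elim (clash (core-Y⁺ T (w∈Y , p , ¬f)) w∉)
              ...   | yes f = full f

            -- All these vertices miss exactly `T`, so any vertex of K or of `Y` outside `top T`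
            -- sees all of them or none; cuts inside `top T` come from the paw-free decomposition.
            decomp-top : Decomp (Types G Label) (top T)
            decomp-top = decomp-map types (λ _ x∈ → x∈)
              (paw-free-decomp (top T) (far-paw-free λ x∈ → Y-far (proj₁ (top⁻ T x∈))))
              where
              types : ∀ {S} → S ⊑ top T → Uniform (top T) S → Types G Label S
              types {S} S⊆ (active , inert , alike) = KY-types (λ x∈ → inj₂ (∈Y x∈)) active
                (λ k∈ _ k∈K _ _ _ → ⊥-elim (clash k∈K (Y∩K=∅ (∈Y k∈)))) hom
                where
                ∈Y : ∀ {x} → x ∈ S → x ∈ Y
                ∈Y x∈ = proj₁ (top⁻ T (S⊆ _ x∈))
                hom : ∀ {y y′ w} → y ∈ S → y′ ∈ S → y ∈ Y → y′ ∈ Y → active y ≡ active y′ → KY w → w ∉ S → adj G y w ≡ adj G y′ w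
                hom {y} {y′} {w} y∈ y′∈ y∈Y y′∈Y e kw w∉ with top⁻ T (S⊆ y y∈) | top⁻ T (S⊆ y′ y′∈)
                hom {y} {y′} {w} y∈ y′∈ y∈Y y′∈Y e (inj₁ w∈K) w∉ | _ , wy , fy | _ , wy′ , fy′ =
                  ⊴-adj (λ k v~k h → fy′ k (wy k v~k h)) (λ k v~k h → fy k (wy′ k v~k h)) w∈K
                hom {y} {y′} {w} y∈ y′∈ y∈Y y′∈Y e (inj₂ w∈Y) w∉ | _ , wy , fy | _ , wy′ , fy′
                  with bool-cases (top T w)
                ... | inj₁ w∈top with bool-cases (active y)
                ...   | inj₁ a = alike y∈ y′∈ a (trans (sym e) a) w∈top w∉
                ...   | inj₂ a = trans (inert y∈ a w∈top w∉) (sym (inert y′∈ (trans (sym e) a) w∈top w∉))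
                hom {y} {y′} {w} y∈ y′∈ y∈Y y′∈Y e (inj₂ w∈Y) w∉ | _ , wy , fy | _ , wy′ , fy′ | inj₂ w∉top
                  with within? T w
                ... | yes ww = trans (sees y∈Y fy) (sym (sees y′∈Y fy′))
                  where
                  ¬f : ¬ Full T w
                  ¬f f = clash (dec-true (top? T w) (w∈Y , ww , f)) w∉top
                  sees : ∀ {y} → y ∈ Y → Full T y → y ~ w
                  sees y∈Y fy = let k , k∈T , w~k = ¬Full⇒ ¬f in ~-sym (◁⇒adjacent (Y⊆X w∈Y) (Y-far y∈Y)
                    ((λ k v~k h → fy k (ww k v~k h)) , k , (T⊆K k k∈T , fy k k∈T) , w~k))
                ... | no ¬ww with closed w∈Y
                ...   | inj₁ ww = ⊥-elim (¬ww ww)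
                ...   | inj₂ (inj₁ fw) = trans (sees y∈Y wy) (sym (sees y′∈Y wy′))
                  where
                  sees : ∀ {y} → y ∈ Y → Within T y → y ~ w
                  sees y∈Y wy = ◁⇒adjacent (Y⊆X y∈Y) (Y-far w∈Y) ((λ k v~k h → fw k (wy k v~k h)) , beyond ¬ww wy)
                ...   | inj₂ (inj₂ aw) = trans (avoids y∈Y wy) (sym (avoids y′∈Y wy′))
                  where
                  avoids : ∀ {y} → y ∈ Y → Within T y → y ≁ w
                  avoids y∈Y wy = disjoint⇒nonadjacent (Y⊆X y∈Y) (Y⊆X w∈Y) (λ k v~k h → aw k (wy k v~k h))

            decomp-block : Decomp (Types G Label) (core T) → Decomp (Types G Label) (block T)
            decomp-block D = node (core T) (top T) (λ _ → refl) disjoint block-types D decomp-top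
              where
              disjoint : ∀ x → x ∈ core T → x ∉ top T
              disjoint x x∈ with core⁻ T x∈
              ... | inj₁ x∈T = dec-false (top? T x) λ (x∈Y , _) → clash (T⊆K x x∈T) (Y∩K=∅ x∈Y)
              ... | inj₂ (_ , _ , ¬f) = dec-false (top? T x) λ (_ , _ , f) → ¬f f

            -- Maximality among proper closed subsets makes the complement of the half in T closed as well.
            record Half : Set where
              field
                half     : VSet (n G)
                half⊆    : half ⊑ T
                h-closed : Closed half
                inner    : ∃ (_∈ half)
                outer    : ∃ λ z → z ∈ T × z ∉ half
                maximal  : ∀ {d} → d ∈ Y → Within T d → Full half d → ¬ Full T d → Within half d

            missedBy : V → VSet (n G)
            missedBy d k = adj G v k ∧ not (adj G d k)

            missedBy⁻ : ∀ {d k} → k ∈ missedBy d → Misses d k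
            missedBy⁻ h = let a , b = ∧-true⁻ h in a , not-injective b

            missedBy⁺ : ∀ {d k} → Misses d k → k ∈ missedBy d
            missedBy⁺ (a , b) = cong₂ (λ a b → a ∧ not b) a b

            -- The three alternatives of `laminar` are exactly those of `Closed`.
            closed-missedBy : ∀ {d} → d ∈ Y → Closed (missedBy d)
            closed-missedBy d∈Y e∈Y with laminar (Y⊆X d∈Y) (Y⊆X e∈Y)
            ... | inj₁ p = inj₂ (inj₁ λ k k∈ → let a , b = missedBy⁻ k∈ in p k a b)
            ... | inj₂ (inj₁ p) = inj₁ λ k v~k e≁k → missedBy⁺ (v~k , p k v~k e≁k)
            ... | inj₂ (inj₂ p) = inj₂ (inj₂ λ k k∈ → let a , b = missedBy⁻ k∈ in p k a b)

            remaining : VSet (n G) → VSet (n G)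
            remaining S x = T x ∧ not (S x)

            remaining⁻ : ∀ S {x} → x ∈ remaining S → x ∈ T × x ∉ S
            remaining⁻ S h = let a , b = ∧-true⁻ h in a , not-injective b

            -- A missed set strictly between `S` and `T` replaces `S`. It is closed by laminarity,
            -- and what remains of `T` shrinks, so the process stops at a half with the maximality
            -- property.
            enlarge : ∀ b S → size (remaining S) < b → S ⊑ T → Closed S → ∃ (_∈ S) → (∃ λ z → z ∈ T × z ∉ S) → Half
            enlarge (suc b) S (s≤s p) S⊆ S-closed inner outer
              with any? (λ d → (Y d ≟ true) ×-dec within? T d ×-dec full? S d ×-dec ¬? (full? T d) ×-dec ¬? (within? S d))
            ... | no none = record
                    { half = S ; half⊆ = S⊆ ; h-closed = S-closed ; inner = inner ; outer = outer
                    ; maximal = λ {d} d∈Y w f ¬f → case within? S d of λ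
                        { (yes w′) → w′ ; (no ¬w) → ⊥-elim (none (d , d∈Y , w , f , ¬f , ¬w)) } }
            ... | yes (d , d∈Y , w , f , ¬f , ¬w) = enlarge b (missedBy d) (≤-trans shrink p)
                    (λ k k∈ → let a , c = missedBy⁻ k∈ in w k a c) (closed-missedBy d∈Y)
                    (let x , x∈S = inner in x , missedBy⁺ (T⊆K x (S⊆ x x∈S) , f x x∈S))
                    (let z , z∈T , d~z = ¬Full⇒ ¬f in z , z∈T , trans (cong (λ b → adj G v z ∧ not b) d~z) (∧-zeroʳ _))
              where
              shrink : size (remaining (missedBy d)) < size (remaining S)
              shrink with ¬Within⇒ ¬w
              ... | k , (v~k , d≁k) , k∉S = size-< k
                (λ y y∈ → let y∈T , y∉ = remaining⁻ (missedBy d) y∈ in cong₂ (λ a b → a ∧ not b) y∈T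
                  (≢true⇒≡false λ y∈S → clash (missedBy⁺ (T⊆K y y∈T , f y y∈S)) y∉))
                (cong₂ (λ a b → a ∧ not b) (w k v~k d≁k) k∉S)
                (trans (cong (λ b → T k ∧ not b) (missedBy⁺ (v~k , d≁k))) (∧-zeroʳ _))

            halve : ∀ {x z} → x ∈ T → z ∈ T → z ≢ x → Half
            halve {x} {z} x∈T z∈T z≢x = enlarge _ (λ y → eq? y x) ≤-refl (λ y y=x → subst (_∈ T) (sym (eq?⁻ y=x)) x∈T)
              singleton-closed (x , eq?-refl x) (z , z∈T , eq?-≢ z≢x)
              where
              -- A single vertex is either seen or missed, so no missed set can cross it.
              singleton-closed : Closed (λ y → eq? y x)
              singleton-closed {d} _ with ~? d x
              ... | inj₁ d~x = inj₂ (inj₂ λ k k=x → subst (d ~_) (sym (eq?⁻ k=x)) d~x)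
              ... | inj₂ d≁x = inj₂ (inj₁ λ k k=x → subst (d ≁_) (sym (eq?⁻ k=x)) d≁x)

            module Halves (H : Half) where
              open Half H

              other : VSet (n G)
              other = remaining half

              other⁻ : ∀ {x} → x ∈ other → x ∈ T × x ∉ half
              other⁻ = remaining⁻ half

              other⁺ : ∀ {x} → x ∈ T → x ∉ half → x ∈ other
              other⁺ = cong₂ (λ a b → a ∧ not b)

              halves : ∀ {x} → x ∈ T → x ∈ half ⊎ x ∈ other
              halves {x} x∈T with bool-cases (half x)
              ... | inj₁ h = inj₁ h
              ... | inj₂ h = inj₂ (other⁺ x∈T h)

              Within-half⇒Apart-other : ∀ {d} → Within half d → Apart other d
              Within-half⇒Apart-other {d} w k k∈ with ~? d k | other⁻ k∈
              ... | inj₁ h | _ = h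
              ... | inj₂ h | k∈T , k∉ = ⊥-elim (clash (w k (T⊆K k k∈T) h) k∉)

              Apart-half⇒Within-other : ∀ {d} → Within T d → Apart half d → Within other d
              Apart-half⇒Within-other w a k v~k d≁k with halves (w k v~k d≁k)
              ... | inj₁ k∈half = ⊥-elim (clash (a k k∈half) d≁k)
              ... | inj₂ k∈other = k∈other

              -- A missed set inside `T` could cross `other` only by containing `half` strictly
              -- without filling `T`, which maximality excludes.
              other-closed : Closed other
              other-closed {d} d∈Y with closed d∈Y
              ... | inj₂ (inj₁ f) = inj₂ (inj₁ λ k k∈ → f k (proj₁ (other⁻ k∈)))
              ... | inj₂ (inj₂ a) = inj₂ (inj₂ λ k k∈ → a k (proj₁ (other⁻ k∈)))
              ... | inj₁ w with h-closed d∈Y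
              ...   | inj₁ w′ = inj₂ (inj₂ (Within-half⇒Apart-other w′))
              ...   | inj₂ (inj₂ a) = inj₁ (Apart-half⇒Within-other w a)
              ...   | inj₂ (inj₁ f) with full? T d
              ...     | yes f′ = inj₂ (inj₁ λ k k∈ → f′ k (proj₁ (other⁻ k∈)))
              ...     | no ¬f = inj₂ (inj₂ (Within-half⇒Apart-other (maximal d∈Y w f ¬f)))

              -- A missed set strictly inside `T` lies in one of the two halves. Conversely, one
              -- inside a half cannot fill `T`, as `inner` and `outer` witness that both halves are
              -- inhabited.
              core-split : ∀ x → core T x ≡ block half x ∨ block other x
              core-split x = ≡-from-⇔ to (λ h → from (∨-true⁻ h))
                where
                to : x ∈ core T → block half x ∨ block other x ≡ true
                to x∈ with core⁻ T x∈
                to x∈ | inj₁ x∈T with halves x∈T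
                ... | inj₁ h = ∨-trueˡ _ (∨-trueˡ _ (core-K⁺ half h))
                ... | inj₂ h = ∨-trueʳ (block half x) (∨-trueˡ _ (core-K⁺ other h))
                to x∈ | inj₂ (x∈Y , w , ¬f) with h-closed x∈Y
                ... | inj₁ w′ = ∨-trueˡ _ (block-Y⁺ half x∈Y w′)
                ... | inj₂ (inj₁ f) = ∨-trueˡ _ (block-Y⁺ half x∈Y (maximal x∈Y w f ¬f))
                ... | inj₂ (inj₂ a) = ∨-trueʳ (block half x) (block-Y⁺ other x∈Y (Apart-half⇒Within-other w a))
                from : x ∈ block half ⊎ x ∈ block other → x ∈ core T
                from (inj₁ h) with block⁻ half h
                ... | inj₁ p = core-K⁺ T (half⊆ x p)
                ... | inj₂ (x∈Y , w) = core-Y⁺ T (x∈Y , (λ k v~k h → half⊆ k (w k v~k h)) , λ f →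
                        let z , z∈T , z∉ = outer in clash (w z (T⊆K z z∈T) (f z z∈T)) z∉)
                from (inj₂ h) with block⁻ other h
                ... | inj₁ p = core-K⁺ T (proj₁ (other⁻ p))
                ... | inj₂ (x∈Y , w) = core-Y⁺ T (x∈Y , (λ k v~k h → proj₁ (other⁻ (w k v~k h))) , λ f →
                        let z , z∈ = inner ; z∈T = half⊆ z z∈ in
                        clash z∈ (proj₂ (other⁻ (w z (T⊆K z z∈T) (f z z∈T)))))

              -- A vertex of `Y` in both blocks would have its missed set inside two disjoint
              -- halves, but that set is nonempty because `Y` lies in `X`.
              blocks-disjoint : ∀ x → x ∈ block half → x ∉ block other
              blocks-disjoint x h = ≢true⇒≡false λ h′ → apart (block⁻ half h) (block⁻ other h′)
                where
                apart : x ∈ half ⊎ (x ∈ Y × Within half x) → x ∈ other ⊎ (x ∈ Y × Within other x) → ⊥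
                apart (inj₁ p) (inj₁ q) = clash p (proj₂ (other⁻ q))
                apart (inj₁ p) (inj₂ (q , _)) = clash (T⊆K x (half⊆ x p)) (Y∩K=∅ q)
                apart (inj₂ (p , _)) (inj₁ q) = clash (T⊆K x (proj₁ (other⁻ q))) (Y∩K=∅ p)
                apart (inj₂ (p , w)) (inj₂ (_ , w′)) =
                  let k , v~k , x≁k = missed p in clash (w k v~k x≁k) (proj₂ (other⁻ (w′ k v~k x≁k)))

          decomp-closed : ∀ b T → size T < b → T ⊑ K → Closed T → Decomp (Types G Label) (block T)
          decomp-closed (suc b) T (s≤s p) T⊆K closed with any? (λ x → T x ≟ true)
          ... | no none = empty λ x → ≢true⇒≡false λ x∈ → case block⁻ T x∈ of λ
                  { (inj₁ x∈T) → none (x , x∈T)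
                  ; (inj₂ (x∈Y , w)) → let k , v~k , x≁k = missed x∈Y in none (k , w k v~k x≁k) }
          ... | yes (x , x∈T) with any? (λ z → (T z ≟ true) ×-dec ¬? (z ≟ᶠ x))
          -- Over a single vertex x, a nonempty missed set inside `T` is all of `T`, so the core
          -- consists of x alone.
          ...   | no only = decomp-block (leaf x (core-K⁺ T x∈T) single)
            where
            open Split T⊆K closed
            single-T : ∀ y → y ∈ T → y ≡ x
            single-T y y∈T with y ≟ᶠ x
            ... | yes e = e
            ... | no ne = ⊥-elim (only (y , y∈T , ne))
            single : ∀ y → y ∈ core T → y ≡ x
            single y y∈ with core⁻ T y∈
            ... | inj₁ y∈T = single-T y y∈T
            ... | inj₂ (y∈Y , w , ¬f) = let k , v~k , y≁k = missed y∈Y in ⊥-elim (¬f λ z z∈T →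
                    subst (y ≁_) (trans (single-T k (w k v~k y≁k)) (sym (single-T z z∈T))) y≁k)
          ...   | yes (z , z∈T , z≢x) = decomp-block (node (block half) (block other) core-split blocks-disjoint core-types
                  (decomp-closed b half (≤-trans half< p) (λ y y∈ → T⊆K y (half⊆ y y∈)) h-closed)
                  (decomp-closed b other (≤-trans other< p) (λ y y∈ → T⊆K y (proj₁ (other⁻ y∈))) other-closed))
            where
            open Split T⊆K closed
            H = halve x∈T z∈T z≢x
            open Half H
            open Halves H
            half< : size half < size T
            half< = let y , y∈T , y∉ = outer in size-< y half⊆ y∈T y∉
            other< : size other < size T
            other< = let y , y∈ = inner in size-< y (λ w w∈ → proj₁ (other⁻ w∈)) (half⊆ y y∈)
              (≢true⇒≡false λ y∈o → clash y∈ (proj₂ (other⁻ y∈o)))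

          decomp-all : Decomp (Types G Label) (λ _ → true)
          decomp-all = node rest (λ x → eq? x v) split (λ x x∈ → eq?-≢ λ { refl → clash x∈ v∉rest }) all-types
            -- Every missed set lies in K, so K is closed and its block is all of K ∪ `Y`.
            (node R (block K) (λ _ → refl) disjoint rest-types decomp-R
              (decomp-closed _ K ≤-refl (λ _ x∈ → x∈) (λ _ → inj₁ λ k v~k _ → v~k)))
            (leaf v (eq?-refl v) λ _ → eq?⁻)
            where
            rest : VSet (n G)
            rest x = R x ∨ block K x
            disjoint : ∀ x → x ∈ R → x ∉ block K
            disjoint x x∈R = ≢true⇒≡false λ x∈ → case block⁻ K x∈ of λ
              { (inj₁ x∈K) → clash x∈K (proj₂ (proj₁ (R⁻ x∈R))) ; (inj₂ (x∈Y , _)) → clash x∈Y (proj₂ (R⁻ x∈R)) }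
            v∉rest : v ∉ rest
            v∉rest = ≢true⇒≡false λ v∈ → case ∨-true⁻ {R v} v∈ of λ
              { (inj₁ v∈R) → proj₁ (proj₁ (R⁻ v∈R)) refl
              ; (inj₂ v∈) → case block⁻ K v∈ of λ
                { (inj₁ v∈K) → ~⇒≢ v∈K refl ; (inj₂ (v∈Y , _)) → clash v∈Y v∉Y } }
            split : ∀ x → true ≡ rest x ∨ eq? x v
            split x with kind x
            ... | is-v refl = sym (∨-trueʳ (rest x) (eq?-refl v))
            ... | in-K h = sym (∨-trueˡ _ (∨-trueʳ (R x) (∨-trueˡ _ (core-K⁺ K h))))
            ... | in-Y h = sym (∨-trueˡ _ (∨-trueʳ (R x) (block-Y⁺ K h λ k v~k _ → v~k)))
            ... | in-R h = sym (∨-trueˡ _ (∨-trueˡ _ h))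
            all-types : Types G Label (λ _ → true)
            all-types = (λ _ → false , false , false) , λ _ _ _ ()
            rest-types : Types G Label rest
            rest-types = (λ u → K u , false , false) , λ {u} {u′} {w} _ _ e w∉ → sep e w∉ (∨-true⁻ (sym (split w)))
              where
              sep : ∀ {u u′ w} → (K u , false , false) ≡ (K u′ , false , false) → w ∉ rest →
                    w ∈ rest ⊎ eq? w v ≡ true → adj G u w ≡ adj G u′ w
              sep e w∉ (inj₁ w∈) = ⊥-elim (clash w∈ w∉)
              sep {u} {u′} e w∉ (inj₂ w=v) rewrite eq?⁻ w=v =
                trans (proj₁ simple u v) (trans (cong proj₁ e) (proj₁ simple v u′))

        -- Choosing a layout: incomparable missed sets, long chains, short chains

        place : ∀ w → w ≡ v ⊎ v ~ w ⊎ Far w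
        place w with w ≟ᶠ v | ~? v w
        ... | yes w≡v | _         = inj₁ w≡v
        ... | no _    | inj₁ v~w  = inj₂ (inj₁ v~w)
        ... | no w≢v  | inj₂ v≁w  = inj₂ (inj₂ (w≢v , v≁w))

        ∈X : VSet (n G)
        ∈X d = does (x? d)

        -- Here `Y` is all of `X` and `R` is `F`. The single bit `adj G r d` determines the
        -- adjacency of r to every vertex of `X`, and the same fact makes the vertices of `Y` alike
        -- towards `R`.
        layout-incomparable : ∀ {d d′} → X d → X d′ → ¬ d ⊴ d′ → ¬ d′ ⊴ d → Layout
        layout-incomparable {d} {d′} Xd Xd′ d⋬d′ d′⋬d = record
          { Y = ∈X ; Y⊆X = λ {x} → does⁻ (x? x) ; sideR = λ r → adj G r d , false ; sideK = λ _ → false , false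
          ; R-alike = λ {r} {r′} {w} r∈ r′∈ e w∉ → R-alike (R⊆F r∈) (R⊆F r′∈) (cong proj₁ e) w∉
          ; K-alike = λ v~k v~k′ _ r∈ → trans (~-sym (proj₂ (R⊆F r∈) _ v~k)) (sym (~-sym (proj₂ (R⊆F r∈) _ v~k′)))
          ; Y-alike = λ {y} {y′} {r} y∈ y′∈ r∈ →
              trans (proj₁ simple y r) (trans (constant (R⊆F r∈) (does⁻ (x? y) y∈))
                (trans (sym (constant (R⊆F r∈) (does⁻ (x? y′) y′∈))) (proj₁ simple r y′))) }
          where
          R : VSet (n G)
          R x = does (far? x) ∧ not (∈X x)
          disjoint : Disjoint d d′
          disjoint with laminar Xd Xd′
          ... | inj₁ p = ⊥-elim (d⋬d′ p)
          ... | inj₂ (inj₁ p) = ⊥-elim (d′⋬d p)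
          ... | inj₂ (inj₂ p) = p
          agree : ∀ {f} → F f → adj G f d ≡ adj G f d′
          agree {f} Ff with ~? f d | ~? f d′
          ... | inj₁ p | inj₁ q = trans p (sym q)
          ... | inj₂ p | inj₂ q = trans p (sym q)
          ... | inj₁ p | inj₂ q = case F-differ⇒comparable Ff Xd Xd′ p q of λ
                  { (inj₁ h) → ⊥-elim (d⋬d′ h) ; (inj₂ h) → ⊥-elim (d′⋬d h) }
          ... | inj₂ p | inj₁ q = case F-differ⇒comparable Ff Xd′ Xd q p of λ
                  { (inj₁ h) → ⊥-elim (d′⋬d h) ; (inj₂ h) → ⊥-elim (d⋬d′ h) }
          -- M(d) and M(d′) are disjoint, so the nonempty M(e) cannot lie in both; lying inside one
          -- while containing the other would make d and d′ comparable.
          above : ∀ {e} → X e → e ⊴ d ⊎ d ⊴ e → e ⊴ d′ ⊎ d′ ⊴ e → d ⊴ e × d′ ⊴ e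
          above (_ , k , v~k , e≁k) (inj₁ p) (inj₁ q) = ⊥-elim (clash (disjoint k v~k (p k v~k e≁k)) (q k v~k e≁k))
          above _ (inj₁ p) (inj₂ q) = ⊥-elim (d′⋬d (⊴-trans q p))
          above _ (inj₂ p) (inj₁ q) = ⊥-elim (d⋬d′ (⊴-trans p q))
          above _ (inj₂ p) (inj₂ q) = p , q
          strictly : ∀ {a b e} → a ⊴ e → b ⊴ e → ¬ b ⊴ a → a ◁ e
          strictly {a} {b} {e} a⊴e b⊴e b⋬a with ⊴? e a
          ... | inj₁ e⊴a = ⊥-elim (b⋬a (⊴-trans b⊴e e⊴a))
          ... | inj₂ w = a⊴e , w
          -- If f distinguishes e from d, it also distinguishes e from d′, so M(e) strictly contains
          -- both their missed sets. Seeing e but not d contradicts `◁⇒fewer-F`; seeing d but not e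
          -- makes f, d, e, d′ an induced C4.
          constant : ∀ {f e} → F f → X e → adj G f e ≡ adj G f d
          constant {f} {e} Ff Xe with ~? f e | ~? f d
          ... | inj₁ p | inj₁ q = trans p (sym q)
          ... | inj₂ p | inj₂ q = trans p (sym q)
          ... | inj₁ f~e | inj₂ f≁d =
                let d⊴e , d′⊴e = above Xe (F-differ⇒comparable Ff Xe Xd f~e f≁d)
                                          (F-differ⇒comparable Ff Xe Xd′ f~e (trans (sym (agree Ff)) f≁d))
                in ⊥-elim (clash (◁⇒fewer-F Ff Xd Xe (strictly d⊴e d′⊴e d′⋬d) f~e) f≁d)
          ... | inj₂ f≁e | inj₁ f~d =
                let f~d′ = trans (sym (agree Ff)) f~d
                    d⊴e , d′⊴e = above Xe (swap (F-differ⇒comparable Ff Xd Xe f~d f≁e))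
                                          (swap (F-differ⇒comparable Ff Xd′ Xe f~d′ f≁e))
                in ⊥-elim (no-C4 f~d (◁⇒adjacent Xd (proj₁ Xe) (strictly d⊴e d′⊴e d′⋬d))
                     (~-sym (◁⇒adjacent Xd′ (proj₁ Xe) (strictly d′⊴e d⊴e d⋬d′))) (~-sym f~d′) f≁e
                     (disjoint⇒nonadjacent Xd Xd′ disjoint) (λ { refl → ¬X-F Xe Ff }) (λ { refl → d⋬d′ λ _ _ h → h }))
          R⊆F : ∀ {r} → r ∈ R → F r
          R⊆F {r} r∈ with ∧-true⁻ r∈
          ... | far , ¬x with X⊎F (does⁻ (far? r) far)
          ...   | inj₁ Xr = ⊥-elim (clash (dec-true (x? r) Xr) (not-injective ¬x))
          ...   | inj₂ Fr = Fr
          R-alike : ∀ {r r′ w} → F r → F r′ → adj G r d ≡ adj G r′ d → w ∉ R → adj G r w ≡ adj G r′ w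
          R-alike {w = w} Fr Fr′ e w∉ with bool-cases (∈X w) | place w
          ... | inj₁ h | _ = let Xw = does⁻ (x? w) h in trans (constant Fr Xw) (trans e (sym (constant Fr′ Xw)))
          ... | inj₂ _ | inj₁ refl = trans (≁-sym (proj₂ (proj₁ Fr))) (sym (≁-sym (proj₂ (proj₁ Fr′))))
          ... | inj₂ _ | inj₂ (inj₁ v~w) = trans (proj₂ Fr w v~w) (sym (proj₂ Fr′ w v~w))
          ... | inj₂ h | inj₂ (inj₂ far) = ⊥-elim (clash (cong₂ (λ a b → a ∧ not b) (dec-true (far? w) far) h) w∉)

        module Chain (comparable : ∀ {d d′} → X d → X d′ → d ⊴ d′ ⊎ d′ ⊴ d) where

          -- Top vertices miss the largest member of the chain.
          Top Low : V → Set
          Top a = X a × (∀ e → X e → e ⊴ a)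
          Low y = X y × ∃ λ e → X e × y ◁ e

          ◁-from : ∀ {d d′} → X d → X d′ → ¬ d′ ⊴ d → d ◁ d′
          ◁-from {d} {d′} Xd Xd′ d′⋬d with ⊴? d′ d | comparable Xd Xd′
          ... | inj₁ p | _ = ⊥-elim (d′⋬d p)
          ... | _ | inj₂ p = ⊥-elim (d′⋬d p)
          ... | inj₂ w | inj₁ p = p , w

          ⊴?′ : ∀ d d′ → Dec (d ⊴ d′)
          ⊴?′ d d′ with ⊴? d d′
          ... | inj₁ p = yes p
          ... | inj₂ (k , (v~k , d≁k) , d′~k) = no λ p → clash d′~k (p k v~k d≁k)

          top? : Decidable Top
          top? a = x? a ×-dec all? λ e → x? e →-dec ⊴?′ e a

          low? : Decidable Low
          low? y = x? y ×-dec any? λ e → x? e ×-dec ⊴?′ y e ×-dec any? λ k → misses? e k ×-dec (adj G y k ≟ true)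

          Top⊎Low : ∀ {d} → X d → Top d ⊎ Low d
          Top⊎Low {d} Xd with low? d
          ... | yes l = inj₂ l
          ... | no ¬l = inj₁ (Xd , λ e Xe → case ⊴?′ e d of λ
                  { (yes p) → p ; (no ¬p) → ⊥-elim (¬l (Xd , e , Xe , ◁-from Xd Xe ¬p)) })

          Low◁Top : ∀ {y a} → Low y → Top a → y ◁ a
          Low◁Top (Xy , e , Xe , y◁e) (Xa , top) = ◁-from Xy Xa λ a⊴y → ◁⇒⋬ y◁e (⊴-trans (top e Xe) a⊴y)

          Low-Top-adj : ∀ {y a} → Low y → Top a → y ~ a
          Low-Top-adj Ly Ta = ◁⇒adjacent (proj₁ Ly) (proj₁ (proj₁ Ta)) (Low◁Top Ly Ta)

          topMiss : V → Bool
          topMiss k = does (any? λ a → top? a ×-dec (adj G a k ≟ false))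

          -- Top vertices lie below one another, hence all miss the same set, and one bit per vertex
          -- of K records it.
          topMiss-≁ : ∀ {a k} → Top a → v ~ k → adj G a k ≡ not (topMiss k)
          topMiss-≁ {a} {k} Ta@(Xa , top) v~k with ~? a k
          ... | inj₂ a≁k = trans a≁k (sym (cong not (dec-true (any? λ a → top? a ×-dec (adj G a k ≟ false)) (a , Ta , a≁k))))
          ... | inj₁ a~k = trans a~k (sym (cong not (dec-false (any? λ a → top? a ×-dec (adj G a k ≟ false))
                  λ (a′ , (Xa′ , _) , a′≁k) → clash a~k (top a′ Xa′ k v~k a′≁k))))

          module TwoLevels {y₁ y₂} (L₁ : Low y₁) (L₂ : Low y₂) (y₁◁y₂ : y₁ ◁ y₂) where

            -- Some e lies strictly above y′, and y, y′, e form a far triangle. A vertex f seeing y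
            -- must see y′ or e by paw-freeness, and seeing e entails seeing y′.
            differ-agree : ∀ {f y y′} → F f → Low y → Low y′ → y ◁ y′ → adj G f y ≡ adj G f y′
            differ-agree {f} {y} {y′} Ff@((_ , v≁f) , _) (Xy , _) (Xy′ , e , Xe , y′◁e@(y′⊴e , k , m , y′~k)) y◁y′@(y⊴y′ , _) =
              ≡-from-⇔ down (◁⇒fewer-F Ff Xy Xy′ y◁y′)
              where
              y◁e : y ◁ e
              y◁e = ◁-from Xy Xe λ e⊴y → ◁⇒⋬ y′◁e (⊴-trans e⊴y y⊴y′)
              down : f ~ y → f ~ y′
              down f~y with far-paw-free {λ z → does (far? z)} (λ {z} → does⁻ (far? z))
                  (dec-true (far? y) (proj₁ Xy)) (dec-true (far? y′) (proj₁ Xy′)) (dec-true (far? e) (proj₁ Xe))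
                  (dec-true (far? f) (proj₁ Ff)) (◁⇒adjacent Xy (proj₁ Xy′) y◁y′) (◁⇒adjacent Xy (proj₁ Xe) y◁e)
                  (◁⇒adjacent Xy′ (proj₁ Xe) y′◁e) (~-sym f~y)
              ... | inj₁ f~y′ = f~y′
              ... | inj₂ f~e = ◁⇒fewer-F Ff Xy′ Xe y′◁e f~e

            via : ∀ {f y z} → F f → Low y → Low z → ¬ (y ⊴ z × z ⊴ y) → adj G f y ≡ adj G f z
            via {f} {y} {z} Ff Ly Lz ne with ⊴?′ y z | ⊴?′ z y
            ... | yes p | yes q = ⊥-elim (ne (p , q))
            ... | _ | no ¬q = differ-agree Ff Ly Lz (◁-from (proj₁ Ly) (proj₁ Lz) ¬q)
            ... | no ¬p | _ = sym (differ-agree Ff Lz Ly (◁-from (proj₁ Lz) (proj₁ Ly) ¬p))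

            constant : ∀ {f y} → F f → Low y → adj G f y ≡ adj G f y₁
            constant {f} {y} Ff Ly with ⊴?′ y y₁ | ⊴?′ y₁ y
            ... | no ¬p | _ = via Ff Ly L₁ λ (p , _) → ¬p p
            ... | _ | no ¬p = via Ff Ly L₁ λ (_ , p) → ¬p p
            -- When y and `y₁` miss the same set they cannot be compared strictly; `y₂`, strictly
            -- above both, mediates.
            ... | yes y⊴y₁ | yes _ = trans (via Ff Ly L₂ λ (_ , y₂⊴y) → ◁⇒⋬ y₁◁y₂ (⊴-trans y₂⊴y y⊴y₁))
                                           (sym (differ-agree Ff L₁ L₂ y₁◁y₂))

            ∈Low : VSet (n G)
            ∈Low y = does (low? y)

            R : VSet (n G)
            R x = does (far? x) ∧ not (∈Low x)

            R⁻ : ∀ {r} → r ∈ R → F r ⊎ Top r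
            R⁻ {r} r∈ with ∧-true⁻ r∈
            ... | far , ¬low with X⊎F (does⁻ (far? r) far)
            ...   | inj₂ Fr = inj₁ Fr
            ...   | inj₁ Xr with Top⊎Low Xr
            ...     | inj₁ Tr = inj₂ Tr
            ...     | inj₂ Lr = ⊥-elim (clash (dec-true (low? r) Lr) (not-injective ¬low))

            layout : Layout
            layout = record
              { Y = ∈Low ; Y⊆X = λ {y} y∈ → proj₁ (does⁻ (low? y) y∈)
              -- The first bit separates `F` from the top vertices. The second is the common
              -- adjacency of r to all low vertices, which is always true for top r.
              ; sideR = λ r → does (f? r) , adj G r y₁ ; sideK = λ k → topMiss k , false
              ; R-alike = λ {r} {r′} {w} r∈ r′∈ e w∉ → R-alike {w = w} (R⁻ r∈) (R⁻ r′∈) e w∉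
              ; K-alike = λ {k} {k′} {r} v~k v~k′ e r∈ → K-alike v~k v~k′ (cong proj₁ e) (R⁻ r∈)
              ; Y-alike = λ {y} {y′} {r} y∈ y′∈ r∈ → Y-alike (does⁻ (low? y) y∈) (does⁻ (low? y′) y′∈) (R⁻ r∈) }
              where
              same-kind : ∀ {r r′} → F r → Top r′ → does (f? r) ≡ does (f? r′) → ⊥
              same-kind {r} {r′} Fr Tr′ e = ¬X-F (proj₁ Tr′) (does⁻ (f? r′) (trans (sym e) (dec-true (f? r) Fr)))
              near : ∀ {w r r′} → w ≡ v ⊎ v ~ w → F r ⊎ Top r → F r′ ⊎ Top r′ → does (f? r) ≡ does (f? r′) → adj G r w ≡ adj G r′ w
              near _ (inj₁ Fr) (inj₂ Tr′) e = ⊥-elim (same-kind Fr Tr′ e)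
              near _ (inj₂ Tr) (inj₁ Fr′) e = ⊥-elim (same-kind Fr′ Tr (sym e))
              near (inj₁ refl) (inj₁ ((_ , p) , _)) (inj₁ ((_ , q) , _)) _ = trans (≁-sym p) (sym (≁-sym q))
              near (inj₁ refl) (inj₂ (((_ , p) , _) , _)) (inj₂ (((_ , q) , _) , _)) _ = trans (≁-sym p) (sym (≁-sym q))
              near (inj₂ v~w) (inj₁ (_ , full)) (inj₁ (_ , full′)) _ = trans (full _ v~w) (sym (full′ _ v~w))
              near (inj₂ v~w) (inj₂ Tr) (inj₂ Tr′) _ = trans (topMiss-≁ Tr v~w) (sym (topMiss-≁ Tr′ v~w))
              low : ∀ {w r r′} → Low w → F r ⊎ Top r → F r′ ⊎ Top r′ → (does (f? r) , adj G r y₁) ≡ (does (f? r′) , adj G r′ y₁) →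
                    adj G r w ≡ adj G r′ w
              low _ (inj₁ Fr) (inj₂ Tr′) e = ⊥-elim (same-kind Fr Tr′ (cong proj₁ e))
              low _ (inj₂ Tr) (inj₁ Fr′) e = ⊥-elim (same-kind Fr′ Tr (sym (cong proj₁ e)))
              low Lw (inj₁ Fr) (inj₁ Fr′) e = trans (constant Fr Lw) (trans (cong proj₂ e) (sym (constant Fr′ Lw)))
              low Lw (inj₂ Tr) (inj₂ Tr′) _ = trans (~-sym (Low-Top-adj Lw Tr)) (sym (~-sym (Low-Top-adj Lw Tr′)))
              R-alike : ∀ {r r′ w} → F r ⊎ Top r → F r′ ⊎ Top r′ → (does (f? r) , adj G r y₁) ≡ (does (f? r′) , adj G r′ y₁) →
                        w ∉ R → adj G r w ≡ adj G r′ w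
              R-alike {w = w} p q e w∉ with bool-cases (∈Low w) | place w
              ... | inj₁ h | _ = low (does⁻ (low? w) h) p q e
              ... | inj₂ _ | inj₁ w≡v = near (inj₁ w≡v) p q (cong proj₁ e)
              ... | inj₂ _ | inj₂ (inj₁ v~w) = near (inj₂ v~w) p q (cong proj₁ e)
              ... | inj₂ h | inj₂ (inj₂ far) = ⊥-elim (clash (cong₂ (λ a b → a ∧ not b) (dec-true (far? w) far) h) w∉)
              K-alike : ∀ {k k′ r} → v ~ k → v ~ k′ → topMiss k ≡ topMiss k′ → F r ⊎ Top r → adj G k r ≡ adj G k′ r
              K-alike v~k v~k′ e (inj₁ (_ , full)) = trans (~-sym (full _ v~k)) (sym (~-sym (full _ v~k′)))
              K-alike {k} {k′} {r} v~k v~k′ e (inj₂ Tr) = trans (proj₁ simple k r) (trans (topMiss-≁ Tr v~k)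
                (trans (cong not e) (trans (sym (topMiss-≁ Tr v~k′)) (proj₁ simple r k′))))
              Y-alike : ∀ {y y′ r} → Low y → Low y′ → F r ⊎ Top r → adj G y r ≡ adj G y′ r
              Y-alike {y} {y′} {r} Ly Ly′ (inj₁ Fr) = trans (proj₁ simple y r) (trans (constant Fr Ly)
                (trans (sym (constant Fr Ly′)) (proj₁ simple r y′)))
              Y-alike Ly Ly′ (inj₂ Tr) = trans (Low-Top-adj Ly Tr) (sym (Low-Top-adj Ly′ Tr))

          module OneLevel (level : ∀ {y y′} → Low y → Low y′ → y ⊴ y′) where

            -- By `level` all low vertices miss the same set, so a second bit per vertex of K
            -- describes the only other missed set.
            lowMiss : V → Bool
            lowMiss k = does (any? λ y → low? y ×-dec (adj G y k ≟ false))

            lowMiss-≁ : ∀ {y k} → Low y → v ~ k → adj G y k ≡ not (lowMiss k)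
            lowMiss-≁ {y} {k} Ly v~k with ~? y k
            ... | inj₂ y≁k = trans y≁k (sym (cong not (dec-true (any? λ y → low? y ×-dec (adj G y k ≟ false)) (y , Ly , y≁k))))
            ... | inj₁ y~k = trans y~k (sym (cong not (dec-false (any? λ y → low? y ×-dec (adj G y k ≟ false))
                    λ (y′ , Ly′ , y′≁k) → clash y~k (level Ly′ Ly k v~k y′≁k))))

            sideR sideK : V → Bool × Bool
            sideR r = does (f? r) , does (top? r)
            sideK k = topMiss k , lowMiss k

            -- Adjacency between a far vertex and a vertex of K as a function of their sides:
            -- vertices of `F` see everything, the others see the complement of the set missed at
            -- their level.
            value : Bool × Bool → Bool × Bool → Bool
            value (true  , _)     _       = true
            value (false , true)  (t , _) = not t
            value (false , false) (_ , l) = not l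

            value-adj : ∀ {r k} → Far r → v ~ k → adj G r k ≡ value (sideR r) (sideK k)
            value-adj {r} {k} far v~k with bool-cases (does (f? r)) | bool-cases (does (top? r))
            ... | inj₁ f | _ = trans (proj₂ (does⁻ (f? r) f) k v~k)
                    (sym (cong (λ b → value (b , does (top? r)) (sideK k)) f))
            ... | inj₂ f | inj₁ t = trans (topMiss-≁ (does⁻ (top? r) t) v~k) (sym (cong₂ (λ a b → value (a , b) (sideK k)) f t))
            ... | inj₂ f | inj₂ t with X⊎F far
            ...   | inj₂ Fr = ⊥-elim (clash (dec-true (f? r) Fr) f)
            ...   | inj₁ Xr with Top⊎Low Xr
            ...     | inj₁ Tr = ⊥-elim (clash (dec-true (top? r) Tr) t)
            ...     | inj₂ Lr = trans (lowMiss-≁ Lr v~k) (sym (cong₂ (λ a b → value (a , b) (sideK k)) f t))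

            R : VSet (n G)
            -- The factor `true` is what `not (Y x)` reduces to for empty `Y`, so this agrees with
            -- the `R` of the layout.
            R x = does (far? x) ∧ true

            R⁻ : ∀ {r} → r ∈ R → Far r
            R⁻ {r} r∈ = does⁻ (far? r) (proj₁ (∧-true⁻ r∈))

            layout : Layout
            layout = record
              { Y = λ _ → false ; Y⊆X = λ () ; sideR = sideR ; sideK = sideK
              ; R-alike = λ {r} {r′} {w} r∈ r′∈ e w∉ → R-alike {w = w} (R⁻ r∈) (R⁻ r′∈) e w∉
              ; K-alike = λ {k} {k′} {r} v~k v~k′ e r∈ → trans (proj₁ simple k r) (trans (value-adj (R⁻ r∈) v~k)
                  (trans (cong (value (sideR r)) e) (trans (sym (value-adj (R⁻ r∈) v~k′)) (proj₁ simple r k′))))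
              ; Y-alike = λ () }
              where
              R-alike : ∀ {r r′ w} → Far r → Far r′ → sideR r ≡ sideR r′ → w ∉ R → adj G r w ≡ adj G r′ w
              R-alike {w = w} p q e w∉ with place w
              ... | inj₁ refl = trans (≁-sym (proj₂ p)) (sym (≁-sym (proj₂ q)))
              ... | inj₂ (inj₁ v~w) = trans (value-adj p v~w) (trans (cong (λ s → value s (sideK w)) e) (sym (value-adj q v~w)))
              ... | inj₂ (inj₂ far) = ⊥-elim (clash (cong (_∧ true) (dec-true (far? w) far)) w∉)

          layout : Layout
          layout with any? (λ y → low? y ×-dec any? λ y′ → low? y′ ×-dec ¬? (⊴?′ y′ y))
          ... | yes (y , Ly , y′ , Ly′ , y′⋬y) = TwoLevels.layout Ly Ly′ (◁-from (proj₁ Ly) (proj₁ Ly′) y′⋬y)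
          ... | no none = OneLevel.layout λ {y′} {y} Ly′ Ly → case ⊴?′ y′ y of λ
                  { (yes p) → p ; (no ¬p) → ⊥-elim (none (y , Ly , y′ , Ly′ , ¬p)) }

        layout : Layout
        layout with any? (λ d → x? d ×-dec any? λ d′ → x? d′ ×-dec Incomparable? d d′)
          where
          Incomparable? : ∀ d d′ → Dec (¬ d ⊴ d′ × ¬ d′ ⊴ d)
          Incomparable? d d′ with ⊴? d d′ | ⊴? d′ d
          ... | inj₁ p | _ = no λ (¬p , _) → ¬p p
          ... | inj₂ _ | inj₁ q = no λ (_ , ¬q) → ¬q q
          ... | inj₂ (k , (v~k , d≁k) , d′~k) | inj₂ (k′ , (v~k′ , d′≁k′) , d~k′) =
                yes ((λ p → clash d′~k (p k v~k d≁k)) , λ q → clash d~k′ (q k′ v~k′ d′≁k′))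
        ... | yes (d , Xd , d′ , Xd′ , ¬p , ¬q) = layout-incomparable Xd Xd′ ¬p ¬q
        ... | no none = Chain.layout comparable
          where
          comparable : ∀ {d d′} → X d → X d′ → d ⊴ d′ ⊎ d′ ⊴ d
          comparable {d} {d′} Xd Xd′ with ⊴? d d′ | ⊴? d′ d
          ... | inj₁ p | _ = inj₁ p
          ... | inj₂ _ | inj₁ q = inj₂ q
          ... | inj₂ (k , (v~k , d≁k) , d′~k) | inj₂ (k′ , (v~k′ , d′≁k′) , d~k′) = ⊥-elim (none (d , Xd , d′ , Xd′ ,
                (λ p → clash d′~k (p k v~k d≁k)) , λ q → clash d~k′ (q k′ v~k′ d′≁k′)))

      -- Conclusion with three-bit labels

      decomp-V : V → Decomp (Types G (Bool × Bool × Bool)) (λ _ → true)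
      decomp-V u with simplicial (λ _ → true) (u , refl)
      ... | v , _ , simp = Around.Build.decomp-all v (simp refl refl) (Around.layout v (simp refl refl))

bit : Bool → Fin 2
bit false = 0F
bit true  = 1F

bit-injective : ∀ {a b} → bit a ≡ bit b → a ≡ b
bit-injective {false} {false} _ = refl
bit-injective {true}  {true}  _ = refl

encode : Bool × Bool × Bool → Fin 8
encode (a , b , c) = combine (bit a) (combine (bit b) (bit c))

encode-injective : ∀ {s t} → encode s ≡ encode t → s ≡ t
encode-injective {a , b , c} {a′ , b′ , c′} e =
  let p , q = combine-injective (bit a) (combine (bit b) (bit c)) (bit a′) (combine (bit b′) (bit c′)) e
      q₁ , q₂ = combine-injective (bit b) (bit c) (bit b′) (bit c′) q
  in cong₂ _,_ (bit-injective p) (cong₂ _,_ (bit-injective q₁) (bit-injective q₂))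

types-map : ∀ {G} {L L′ : Set} {S} (f : L → L′) → (∀ {s t} → f s ≡ f t → s ≡ t) → Types G L S → Types G L′ S
types-map f f-inj (class , sep) = (λ u → f (class u)) , λ u∈ u′∈ e → sep u∈ u′∈ (f-inj e)

theorem4 : BoundedCW (λ G → IsSimple G × Chordal G × Free P1+paw G)
theorem4 = 24 , λ G (simple , chordal , free) 1≤n →
  -- Three bits give 8 classes, entered as the predecessor 7; the three banks of labels turn them
  -- into 24.
  CliqueWidth.cw-bound G (proj₁ simple) 7 (proj₂ simple) 1≤n
    (decomp-map (λ {T} _ → types-map {G} {S = T} encode encode-injective) (λ _ x∈ → x∈)
      (SimpleGraph.HoleFree.Pawless.decomp-V G simple chordal free (fromℕ< 1≤n)))
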